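{- Let $\kappa_n$ denote the smallest cardinality of a subset $\mathcal{A}\subseteq S_{n+1}$ that covers $S_n$. Then, as $n\to\infty$, $$\frac{(n+1)!}{n^2}(1+o(1))\le \kappa_n\le \frac{\log n}{n^2}(n+1)!\,(1+o(1)).$$
   Context: $S_n$ is the set of all permutations of $[n]=\{1,2,\ldots,n\}$, written as words. A permutation $\rho\in S_{n+1}$ covers $\pi\in S_n$ if $\rho$ has a (not necessarily contiguous) subsequence of length $n$ that is order-isomorphic to $\pi$, i.e. $\rho$ contains $\pi$ as a pattern. A set $\mathcal{A}\subseteq S_{n+1}$ covers $S_n$ if every $\pi\in S_n$ is covered by at least one element of $\mathcal{A}$. $\log$ is the natural logarithm. -}

module Defs where

open import Data.Fin.Base as Fin using (Fin; zero; suc; punchIn; punchOut)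
open import Data.Fin.Permutation using (Permutation′; _⟨$⟩ʳ_; _≈_; insert; remove; insert-punchIn; insert-remove) renaming (id to idₚ)
import Data.Fin.Properties as Fin
open import Data.Integer.Base as ℤ using (+_)
import Data.Integer.Properties as ℤ
open import Data.List.Base using (List; []; _∷_; length; deduplicate; cartesianProductWith; allFin)
open import Data.List.Membership.Propositional.Properties using (∈-allFin)
import Data.List.Membership.Setoid.Properties as Membershipₚ
open import Data.List.Relation.Binary.Pointwise as Pointwise using (Pointwise; []; _∷_; AllPairs-resp-Pointwise; Any-resp-Pointwise)
open import Data.List.Relation.Unary.All as All using (All)
open import Data.List.Relation.Unary.Any as Any using (Any; here; there)
open import Data.List.Relation.Unary.Enumerates.Setoid using (IsEnumeration)
open import Data.List.Relation.Unary.Enumerates.Setoid.Properties using () renaming (deduplicate⁺ to dedup-enumerates)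
import Data.List.Relation.Unary.Unique.DecSetoid as DecUnique
open import Data.List.Relation.Unary.Unique.DecSetoid.Properties using (deduplicate-!)
import Data.List.Relation.Unary.Unique.Setoid as Unique
open import Data.Nat.Base as ℕ using (ℕ; zero; suc)
import Data.Nat.Properties as ℕ
open import Data.Nat.Solver using () renaming (module +-*-Solver to ℕ-Solver)
open import Data.Product.Base using (∃; _×_; _,_; proj₁)
open import Data.Rational.Base as ℚ using (ℚ; 0ℚ; 1ℚ; ½; _/_; mkℚ; positive; nonNegative)
import Data.Rational.Properties as ℚ
open import Data.Rational.Solver using (module +-*-Solver)
open import Data.Rational.Unnormalised.Base as ℚᵘ using (mkℚᵘ; *≡*; *≤*)
import Data.Rational.Unnormalised.Properties as ℚᵘ
open import Data.Sum.Base using (inj₁; inj₂)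
import Data.Vec.Functional as Vector
open import Function.Base using (_∘_)
open import Function.Bundles using (_⇔_; mk⇔; Equivalence)
open import Level using (0ℓ)
open import Relation.Binary.Bundles using (Setoid; DecSetoid)
open import Relation.Binary.PropositionalEquality using (_≡_; _≗_; refl; sym; trans; cong; cong₂; subst; subst₂)
open import Relation.Nullary.Decidable using (Dec; yes; no; map′; _×-dec_; _→-dec_)
open import Relation.Nullary.Negation using (contradiction)

S : ℕ → Setoid 0ℓ 0ℓ
S n = record
  { Carrier       = Permutation′ n
  ; _≈_           = _≈_
  ; isEquivalence = record
    { refl  = λ _ → refl
    ; sym   = λ p i → sym (p i)
    ; trans = λ p q i → trans (p i) (q i)
    }
  }

-- A permutation π is read as the word π 0, π 1, … (letters 0-based).  The map f
-- selects the positions of a subsequence of ρ that is order-isomorphic to π.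
infix 4 _Contains_
_Contains_ : ∀ {m n} → Permutation′ n → Permutation′ m → Set
_Contains_ {m} {n} ρ π = ∃ λ (f : Fin m → Fin n) →
  (∀ i j → i Fin.< j → f i Fin.< f j) ×
  (∀ i j → (π ⟨$⟩ʳ i Fin.< π ⟨$⟩ʳ j) ⇔ (ρ ⟨$⟩ʳ f i Fin.< ρ ⟨$⟩ʳ f j))

_Covers_ : ∀ {n} → Permutation′ (suc n) → Permutation′ n → Set
ρ Covers π = ρ Contains π

CoversAll : ∀ {n} → List (Permutation′ (suc n)) → Set
CoversAll {n} A = (π : Permutation′ n) → Any (_Covers π) A

-- A k-element subset of S (suc n) is a list of length k without repetitions;
-- repetition is up to pointwise equality, as permutations carry inverse proofs.
CoveringOfSize : ℕ → ℕ → Set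
CoveringOfSize n k = ∃ λ (A : List (Permutation′ (suc n))) →
  Unique.Unique (S (suc n)) A × length A ≡ k × CoversAll A

S-dec : ℕ → DecSetoid 0ℓ 0ℓ
S-dec n = record
  { Carrier          = Permutation′ n
  ; _≈_              = _≈_
  ; isDecEquivalence = record
    { isEquivalence = Setoid.isEquivalence (S n)
    ; _≟_           = λ π ρ → Fin.all? λ i → π ⟨$⟩ʳ i Fin.≟ ρ ⟨$⟩ʳ i
    }
  }

Contains-resp : ∀ {m n} {ρ ρ′ : Permutation′ n} {π π′ : Permutation′ m} →
                ρ ≈ ρ′ → π ≈ π′ → ρ Contains π → ρ′ Contains π′
Contains-resp e d (f , mono , iso) = f , mono , λ i j → mk⇔
  (subst₂ Fin._<_ (e _) (e _) ∘ Equivalence.to (iso i j) ∘ subst₂ Fin._<_ (sym (d i)) (sym (d j)))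
  (subst₂ Fin._<_ (d i) (d j) ∘ Equivalence.from (iso i j) ∘ subst₂ Fin._<_ (sym (e _)) (sym (e _)))

any-function? : ∀ {m n} {P : (Fin m → Fin n) → Set} →
                (∀ {f g} → f ≗ g → P f → P g) → (∀ f → Dec (P f)) → Dec (∃ P)
any-function? {zero} resp P? = map′ (_ ,_) (λ (_ , p) → resp (λ ()) p) (P? λ ())
any-function? {suc m} {P = P} resp P? = map′
  (λ (x , f , p) → (x Vector.∷ f) , p)
  (λ (f , p) → f zero , f ∘ suc , resp (λ { zero → refl ; (suc _) → refl }) p)
  (Fin.any? λ x → any-function? {P = λ f → P (x Vector.∷ f)}
    (λ e → resp λ { zero → refl ; (suc i) → e i }) λ f → P? (x Vector.∷ f))

contains? : ∀ {m n} (ρ : Permutation′ n) (π : Permutation′ m) → Dec (ρ Contains π)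
contains? ρ π = any-function?
  (λ e (mono , iso) →
      (λ i j → subst₂ Fin._<_ (e i) (e j) ∘ mono i j)
    , (λ i j → mk⇔
        (subst₂ Fin._<_ (cong (ρ ⟨$⟩ʳ_) (e i)) (cong (ρ ⟨$⟩ʳ_) (e j)) ∘ Equivalence.to (iso i j))
        (Equivalence.from (iso i j) ∘ subst₂ Fin._<_ (cong (ρ ⟨$⟩ʳ_) (sym (e i))) (cong (ρ ⟨$⟩ʳ_) (sym (e j))))))
  (λ f → (Fin.all? λ i → Fin.all? λ j → (i Fin.<? j) →-dec (f i Fin.<? f j))
    ×-dec (Fin.all? λ i → Fin.all? λ j → map′ (λ (p , q) → mk⇔ p q)
             (λ e → Equivalence.to e , Equivalence.from e)
             (((π ⟨$⟩ʳ i Fin.<? π ⟨$⟩ʳ j) →-dec (ρ ⟨$⟩ʳ f i Fin.<? ρ ⟨$⟩ʳ f j))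
              ×-dec ((ρ ⟨$⟩ʳ f i Fin.<? ρ ⟨$⟩ʳ f j) →-dec (π ⟨$⟩ʳ i Fin.<? π ⟨$⟩ʳ j)))))

insert-cong : ∀ {n} (i : Fin (suc n)) {j k} {π ρ : Permutation′ n} →
              j ≡ k → π ≈ ρ → insert i j π ≈ insert i k ρ
insert-cong i {j} refl e k with i Fin.≟ k
... | yes _   = refl
... | no  i≢k = cong (punchIn j) (e (punchOut i≢k))

insert-0-suc : ∀ {n} (j : Fin (suc n)) (π : Permutation′ n) i →
               insert zero j π ⟨$⟩ʳ suc i ≡ punchIn j (π ⟨$⟩ʳ i)
insert-0-suc j π i = insert-punchIn zero j π i

permutations : ∀ n → List (Permutation′ n)
permutations zero    = idₚ ∷ []
permutations (suc n) = cartesianProductWith (insert zero) (allFin (suc n)) (permutations n)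

permutations-enumerate : ∀ n → IsEnumeration (S n) (permutations n)
permutations-enumerate zero    π = here λ ()
permutations-enumerate (suc n) π = Membershipₚ.∈-resp-≈ (S (suc n)) {permutations (suc n)} {insert zero (π ⟨$⟩ʳ zero) (remove zero π)} {π}
  (insert-remove zero π)
  (Membershipₚ.∈-cartesianProductWith⁺ (Fin.≡-setoid (suc n)) (S n) (S (suc n))
    (λ {_} {_} {ρ} {σ} p e → insert-cong zero {_} {_} {π = ρ} {σ} p e) (∈-allFin (π ⟨$⟩ʳ zero)) (permutations-enumerate n (remove zero π)))

module _ {n} {P : Permutation′ n → Set} (resp : ∀ {π ρ} → π ≈ ρ → P π → P ρ) (P? : ∀ π → Dec (P π)) where

  any-permutation? : Dec (∃ P)
  any-permutation? = map′ Any.satisfied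
    (λ (π , p) → Any.map (λ e → resp e p) (permutations-enumerate n π))
    (Any.any? P? (permutations n))

  all-permutations? : Dec (∀ π → P π)
  all-permutations? = map′
    (λ ps π → All.lookupWith (λ p e → resp (λ i → sym (e i)) p) ps (permutations-enumerate n π))
    (λ p → All.tabulate λ {π} _ → p π)
    (All.all? P? (permutations n))

any-list? : ∀ {n} k {P : List (Permutation′ n) → Set} →
            (∀ {A B} → Pointwise _≈_ A B → P A → P B) → (∀ A → Dec (P A)) →
            Dec (∃ λ A → length A ≡ k × P A)
any-list? zero resp P? = map′ (λ p → [] , refl , p) (λ { ([] , _ , p) → p }) (P? [])
any-list? {n} (suc k) {P} resp P? = map′
  (λ { (x , A , refl , p) → x ∷ A , refl , p })
  (λ { (x ∷ A , e , p) → x , A , ℕ.suc-injective e , p })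
  (any-permutation?
    (λ e (A , l , p) → A , l , resp (e ∷ Pointwise.refl λ _ → refl) p)
    (λ x → any-list? k (λ es → resp ((λ _ → refl) ∷ es)) (λ A → P? (x ∷ A))))

coveringOfSize? : ∀ n k → Dec (CoveringOfSize n k)
coveringOfSize? n k = map′
  (λ (A , l , u , c) → A , u , l , c) (λ (A , u , l , c) → A , l , u , c)
  (any-list? k
    (λ es (u , c) →
        AllPairs-resp-Pointwise ((λ e ne d → ne λ i → trans (d i) (sym (e i))) , (λ e ne d → ne λ i → trans (e i) (d i))) es u
      , λ π → Any-resp-Pointwise (λ {ρ} {σ} e → Contains-resp {ρ = ρ} {σ} {π} {π} e (λ _ → refl)) es (c π))
    (λ A → DecUnique.unique? (S-dec (suc n)) A
      ×-dec all-permutations? (λ {π} {σ} e → Any.map λ {ρ} → Contains-resp {ρ = ρ} {ρ} {π} {σ} (λ _ → refl) e)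
                              (λ π → Any.any? (λ ρ → contains? ρ π) A)))

covering-exists : ∀ n → ∃ (CoveringOfSize n)
covering-exists n = length A , A , deduplicate-! (S-dec (suc n)) (permutations (suc n)) , refl , λ π →
  Any.map (λ {ρ} e → Contains-resp {ρ = insert zero zero π} {ρ} {π} {π} e (λ _ → refl) (extension-contains π))
          (dedup-enumerates (S-dec (suc n)) (permutations-enumerate (suc n)) (insert zero zero π))
  where
  A = deduplicate (DecSetoid._≟_ (S-dec (suc n))) (permutations (suc n))
  extension-contains : ∀ π → insert zero zero π Contains π
  extension-contains π = suc , (λ _ _ → ℕ.s<s) , λ i j → mk⇔
    (subst₂ Fin._<_ (sym (insert-0-suc zero π i)) (sym (insert-0-suc zero π j)) ∘ ℕ.s<s)
    (ℕ.s<s⁻¹ ∘ subst₂ Fin._<_ (insert-0-suc zero π i) (insert-0-suc zero π j))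

least : {P : ℕ → Set} → (∀ k → Dec (P k)) → ∀ k → P k → ∃ λ k → P k × (∀ j → P j → k ℕ.≤ j)
least P? k p with P? 0
... | yes p₀ = 0 , p₀ , λ _ _ → ℕ.z≤n
least P? zero    p | no ¬p₀ = contradiction p ¬p₀
least P? (suc k) p | no ¬p₀ =
  let m , q , min = least (P? ∘ suc) k p
  in suc m , q , λ { zero p₀ → contradiction p₀ ¬p₀ ; (suc j) r → ℕ.s≤s (min j r) }

abstract
  smallest-covering : ∀ n → ∃ λ k → CoveringOfSize n k × (∀ j → CoveringOfSize n j → k ℕ.≤ j)
  smallest-covering n = let k , c = covering-exists n in least (coveringOfSize? n) k c

κ : ℕ → ℕ
κ n = proj₁ (smallest-covering n)

record ℝ : Set where
  field
    seq    : ℕ → ℚ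
    cauchy : ∀ ε → 0ℚ ℚ.< ε → ∃ λ N → ∀ m n → N ℕ.≤ m → N ℕ.≤ n →
             ℚ.∣ seq m ℚ.- seq n ∣ ℚ.≤ ε

open ℝ

-- Arithmetic is termwise on representatives; the order is that of the limits.
infix 4 _≤_
_≤_ : ℝ → ℝ → Set
x ≤ y = ∀ ε → 0ℚ ℚ.< ε → ∃ λ N → ∀ m → N ℕ.≤ m → seq x m ℚ.≤ seq y m ℚ.+ ε

fromℚ : ℚ → ℝ
fromℚ q .seq _ = q
fromℚ q .cauchy ε ε>0 = 0 , λ _ _ _ _ →
  subst (ℚ._≤ ε) (sym (cong ℚ.∣_∣ (ℚ.+-inverseʳ q))) (ℚ.<⇒≤ ε>0)

fromℕ : ℕ → ℝ
fromℕ n = fromℚ (+ n / 1)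

∣-∣-swap : ∀ p q → ℚ.∣ p ℚ.- q ∣ ≡ ℚ.∣ q ℚ.- p ∣
∣-∣-swap p q = trans (sym (ℚ.∣-p∣≡∣p∣ (p ℚ.- q)))
  (cong ℚ.∣_∣ (solve 2 (λ p q → :- (p :- q) := q :- p) refl p q))
  where open +-*-Solver

≤⇒-≤ : ∀ {p q r} → p ℚ.≤ q ℚ.+ r → p ℚ.- q ℚ.≤ r
≤⇒-≤ {p} {q} {r} h = subst (p ℚ.- q ℚ.≤_)
  (solve 2 (λ q r → (q :+ r) :- q := r) refl q r) (ℚ.+-monoˡ-≤ (ℚ.- q) h)
  where open +-*-Solver

∣p∣≤∣q∣+∣p-q∣ : ∀ p q → ℚ.∣ p ∣ ℚ.≤ ℚ.∣ q ∣ ℚ.+ ℚ.∣ p ℚ.- q ∣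
∣p∣≤∣q∣+∣p-q∣ p q = subst (λ r → ℚ.∣ r ∣ ℚ.≤ ℚ.∣ q ∣ ℚ.+ ℚ.∣ p ℚ.- q ∣)
  (solve 2 (λ p q → q :+ (p :- q) := p) refl p q) (ℚ.∣p+q∣≤∣p∣+∣q∣ q (p ℚ.- q))
  where open +-*-Solver

∣p-q∣≤ : ∀ {p q r} → p ℚ.- q ℚ.≤ r → q ℚ.- p ℚ.≤ r → ℚ.∣ p ℚ.- q ∣ ℚ.≤ r
∣p-q∣≤ {p} {q} {r} h k with ℚ.∣p∣≡p∨∣p∣≡-p (p ℚ.- q)
... | inj₁ e = subst (ℚ._≤ r) (sym e) h
... | inj₂ e = subst (ℚ._≤ r) (trans (solve 2 (λ p q → q :- p := :- (p :- q)) refl p q) (sym e)) k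
  where open +-*-Solver

ε/2>0 : ∀ {ε} → 0ℚ ℚ.< ε → 0ℚ ℚ.< ε ℚ.* ½
ε/2>0 {ε} h = ℚ.positive⁻¹ (ε ℚ.* ½) {{ℚ.pos*pos⇒pos ε {{positive h}} ½}}

infix 9 ∣_∣
∣_∣ : ℝ → ℝ
∣ x ∣ .seq n = ℚ.∣ seq x n ∣
∣ x ∣ .cauchy ε ε>0 = let N , h = cauchy x ε ε>0 in N , λ m n N≤m N≤n →
  ℚ.≤-trans
    (∣p-q∣≤ {ℚ.∣ seq x m ∣}
      (≤⇒-≤ {q = ℚ.∣ seq x n ∣} (∣p∣≤∣q∣+∣p-q∣ (seq x m) (seq x n)))
      (≤⇒-≤ {q = ℚ.∣ seq x m ∣} (subst (λ d → ℚ.∣ seq x n ∣ ℚ.≤ ℚ.∣ seq x m ∣ ℚ.+ d)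
        (∣-∣-swap (seq x n) (seq x m)) (∣p∣≤∣q∣+∣p-q∣ (seq x n) (seq x m)))))
    (h m n N≤m N≤n)

infixl 6 _+_
_+_ : ℝ → ℝ → ℝ
(x + y) .seq n = seq x n ℚ.+ seq y n
(x + y) .cauchy ε ε>0 =
  let N , hx = cauchy x (ε ℚ.* ½) (ε/2>0 ε>0)
      M , hy = cauchy y (ε ℚ.* ½) (ε/2>0 ε>0)
  in N ℕ.⊔ M , λ m n h k →
    let a = seq x m ; b = seq x n ; c = seq y m ; d = seq y n in begin
    ℚ.∣ (a ℚ.+ c) ℚ.- (b ℚ.+ d) ∣           ≡⟨ cong ℚ.∣_∣ (solve 4 (λ a b c d → (a :+ c) :- (b :+ d) := (a :- b) :+ (c :- d)) refl a b c d) ⟩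
    ℚ.∣ (a ℚ.- b) ℚ.+ (c ℚ.- d) ∣           ≤⟨ ℚ.∣p+q∣≤∣p∣+∣q∣ (a ℚ.- b) (c ℚ.- d) ⟩
    ℚ.∣ a ℚ.- b ∣ ℚ.+ ℚ.∣ c ℚ.- d ∣         ≤⟨ ℚ.+-mono-≤
                                                 (hx m n (ℕ.m⊔n≤o⇒m≤o N M h) (ℕ.m⊔n≤o⇒m≤o N M k))
                                                 (hy m n (ℕ.m⊔n≤o⇒n≤o N M h) (ℕ.m⊔n≤o⇒n≤o N M k)) ⟩
    ε ℚ.* ½ ℚ.+ ε ℚ.* ½                     ≡⟨ ℚ.*-distribˡ-+ ε ½ ½ ⟨
    ε ℚ.* 1ℚ                                ≡⟨ ℚ.*-identityʳ ε ⟩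
    ε                                       ∎
  where
  open ℚ.≤-Reasoning
  open +-*-Solver

eventually-bounded : ∀ x → ∃ λ B → ℚ.Positive B × ∃ λ N → ∀ n → N ℕ.≤ n → ℚ.∣ seq x n ∣ ℚ.≤ B
eventually-bounded x = let N , h = cauchy x 1ℚ (ℚ.positive⁻¹ 1ℚ) in
    ℚ.∣ seq x N ∣ ℚ.+ 1ℚ
  , ℚ.nonNeg+pos⇒pos ℚ.∣ seq x N ∣ {{ℚ.∣-∣-nonNeg (seq x N)}} 1ℚ
  , N
  , λ n N≤n → ℚ.≤-trans (∣p∣≤∣q∣+∣p-q∣ (seq x n) (seq x N))
                        (ℚ.+-monoʳ-≤ ℚ.∣ seq x N ∣ (h n N N≤n ℕ.≤-refl))

infixl 7 _*_
_*_ : ℝ → ℝ → ℝ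
(x * y) .seq n = seq x n ℚ.* seq y n
(x * y) .cauchy ε ε>0 =
  let B , B>0 , N₁ , hB = eventually-bounded x
      C , C>0 , N₂ , hC = eventually-bounded y
      B+C>0 = ℚ.pos+pos⇒pos B {{B>0}} C {{C>0}}
      B+C≢0 = ℚ.pos⇒nonZero (B ℚ.+ C) {{B+C>0}}
      r     = (ℚ.1/ (B ℚ.+ C)) {{B+C≢0}}
      δ     = ε ℚ.* r
      δ>0   = ℚ.positive⁻¹ δ {{ℚ.pos*pos⇒pos ε {{positive ε>0}} r {{ℚ.1/pos⇒pos (B ℚ.+ C) {{B+C>0}}}}}}
      N₃ , hx = cauchy x δ δ>0
      N₄ , hy = cauchy y δ δ>0
      N     = (N₁ ℕ.⊔ N₂) ℕ.⊔ (N₃ ℕ.⊔ N₄)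
  in N , λ m n h k →
    let a = seq x m ; b = seq x n ; c = seq y m ; d = seq y n
        h₁ = ℕ.m⊔n≤o⇒m≤o N₁ N₂ (ℕ.m⊔n≤o⇒m≤o (N₁ ℕ.⊔ N₂) (N₃ ℕ.⊔ N₄) h)
        k₂ = ℕ.m⊔n≤o⇒n≤o N₁ N₂ (ℕ.m⊔n≤o⇒m≤o (N₁ ℕ.⊔ N₂) (N₃ ℕ.⊔ N₄) k)
        h′ = ℕ.m⊔n≤o⇒n≤o (N₁ ℕ.⊔ N₂) (N₃ ℕ.⊔ N₄) h
        k′ = ℕ.m⊔n≤o⇒n≤o (N₁ ℕ.⊔ N₂) (N₃ ℕ.⊔ N₄) k
    in begin
    ℚ.∣ a ℚ.* c ℚ.- b ℚ.* d ∣                                     ≡⟨ cong ℚ.∣_∣ (solve 4 (λ a b c d → a :* c :- b :* d := a :* (c :- d) :+ d :* (a :- b)) refl a b c d) ⟩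
    ℚ.∣ a ℚ.* (c ℚ.- d) ℚ.+ d ℚ.* (a ℚ.- b) ∣                     ≤⟨ ℚ.∣p+q∣≤∣p∣+∣q∣ (a ℚ.* (c ℚ.- d)) (d ℚ.* (a ℚ.- b)) ⟩
    ℚ.∣ a ℚ.* (c ℚ.- d) ∣ ℚ.+ ℚ.∣ d ℚ.* (a ℚ.- b) ∣               ≡⟨ cong₂ ℚ._+_ (ℚ.∣p*q∣≡∣p∣*∣q∣ a (c ℚ.- d)) (ℚ.∣p*q∣≡∣p∣*∣q∣ d (a ℚ.- b)) ⟩
    ℚ.∣ a ∣ ℚ.* ℚ.∣ c ℚ.- d ∣ ℚ.+ ℚ.∣ d ∣ ℚ.* ℚ.∣ a ℚ.- b ∣       ≤⟨ ℚ.+-mono-≤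
         (product-≤ a (c ℚ.- d) {B} {δ} B>0 (hB m h₁) (hy m n (ℕ.m⊔n≤o⇒n≤o N₃ N₄ h′) (ℕ.m⊔n≤o⇒n≤o N₃ N₄ k′)))
         (product-≤ d (a ℚ.- b) {C} {δ} C>0 (hC n k₂) (hx m n (ℕ.m⊔n≤o⇒m≤o N₃ N₄ h′) (ℕ.m⊔n≤o⇒m≤o N₃ N₄ k′))) ⟩
    B ℚ.* δ ℚ.+ C ℚ.* δ                                           ≡⟨ solve 4 (λ B C ε r → B :* (ε :* r) :+ C :* (ε :* r) := ε :* ((B :+ C) :* r)) refl B C ε r ⟩
    ε ℚ.* ((B ℚ.+ C) ℚ.* r)                                       ≡⟨ cong (ε ℚ.*_) (ℚ.*-inverseʳ (B ℚ.+ C) {{B+C≢0}}) ⟩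
    ε ℚ.* 1ℚ                                                      ≡⟨ ℚ.*-identityʳ ε ⟩
    ε                                                             ∎
  where
  open ℚ.≤-Reasoning
  open +-*-Solver
  product-≤ : ∀ p q {B δ} → ℚ.Positive B → ℚ.∣ p ∣ ℚ.≤ B → ℚ.∣ q ∣ ℚ.≤ δ → ℚ.∣ p ∣ ℚ.* ℚ.∣ q ∣ ℚ.≤ B ℚ.* δ
  product-≤ p q {B} {δ} B>0 hp hq = ℚ.≤-trans
    (ℚ.*-monoʳ-≤-nonNeg ℚ.∣ q ∣ {{ℚ.∣-∣-nonNeg q}} hp)
    (ℚ.*-monoˡ-≤-nonNeg B {{ℚ.pos⇒nonNeg B {{B>0}}}} hq)

Σ< : ℕ → (ℕ → ℚ) → ℚ
Σ< zero    f = 0ℚ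
Σ< (suc k) f = Σ< k f ℚ.+ f k

-- The right-endpoint Riemann sum of ∫₁ⁿ⁺¹ dt/t on the n M intervals of length
-- 1/M: the endpoint t = 1 + (j+1)/M contributes (1/M)(1/t) = 1/(M+j+1).
riemann : ℕ → ℕ → ℚ
riemann n M = Σ< (n ℕ.* M) λ j → + 1 / suc (M ℕ.+ j)

unitFraction : ℕ → ℚ
unitFraction d = + 1 / suc d

unitFraction-anti : ∀ {a b} → a ℕ.≤ b → unitFraction b ℚ.≤ unitFraction a
unitFraction-anti {a} {b} h = ℚ.toℚᵘ-cancel-≤ (ℚᵘ.≤-respˡ-≃ (ℚᵘ.≃-sym (ℚ.toℚᵘ-fromℚᵘ (mkℚᵘ (+ 1) b)))
  (ℚᵘ.≤-respʳ-≃ (ℚᵘ.≃-sym (ℚ.toℚᵘ-fromℚᵘ (mkℚᵘ (+ 1) a)))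
    (*≤* (subst₂ ℤ._≤_ (sym (ℤ.*-identityˡ (+ suc a))) (sym (ℤ.*-identityˡ (+ suc b))) (ℤ.+≤+ (ℕ.s≤s h))))))

archimedean : ∀ ε → 0ℚ ℚ.< ε → ∃ λ N → unitFraction N ℚ.≤ ε
archimedean (mkℚ (+ zero) d c) 0<ε with ℚ.positive 0<ε
... | ()
archimedean (mkℚ ℤ.-[1+ _ ] d c) 0<ε with ℚ.positive 0<ε
... | ()
archimedean (mkℚ (+ suc k) d c) _ = d , ℚ.toℚᵘ-cancel-≤ (ℚᵘ.≤-respˡ-≃ (ℚᵘ.≃-sym (ℚ.toℚᵘ-fromℚᵘ (mkℚᵘ (+ 1) d)))
  (*≤* (ℤ.*-monoʳ-≤-nonNeg (+ suc d) (ℤ.+≤+ {1} {suc k} (ℕ.s≤s ℕ.z≤n)))))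

Σ<-const : ∀ k d → Σ< k (λ _ → unitFraction d) ≡ + k / suc d
Σ<-const zero d = ℚ.toℚᵘ-injective (ℚᵘ.≃-trans (*≡* refl) (ℚᵘ.≃-sym (ℚ.toℚᵘ-fromℚᵘ (mkℚᵘ (+ 0) d))))
Σ<-const (suc k) d = trans (cong (ℚ._+ unitFraction d) (Σ<-const k d)) (ℚ.toℚᵘ-injective
  (ℚᵘ.≃-trans (ℚ.toℚᵘ-homo-+ (+ k / suc d) (unitFraction d))
  (ℚᵘ.≃-trans (ℚᵘ.+-cong (ℚ.toℚᵘ-fromℚᵘ (mkℚᵘ (+ k) d)) (ℚ.toℚᵘ-fromℚᵘ (mkℚᵘ (+ 1) d)))
  (ℚᵘ.≃-trans (*≡* (add (+ k) (+ suc d))) (ℚᵘ.≃-sym (ℚ.toℚᵘ-fromℚᵘ (mkℚᵘ (+ suc k) d)))))))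
  where
  open import Data.Integer.Solver using () renaming (module +-*-Solver to ℤ-Solver)
  open ℤ-Solver
  add : ∀ k d → (k ℤ.* d ℤ.+ + 1 ℤ.* d) ℤ.* d ≡ (+ 1 ℤ.+ k) ℤ.* (d ℤ.* d)
  add = solve 2 (λ k d → (k :* d :+ con (+ 1) :* d) :* d := (con (+ 1) :+ k) :* (d :* d)) refl

Σ<-block : ∀ k d → Σ< (suc k) (λ _ → unitFraction (k ℕ.+ d ℕ.* suc k)) ≡ unitFraction d
Σ<-block k d = trans (Σ<-const (suc k) (k ℕ.+ d ℕ.* suc k))
  (ℚ.fromℚᵘ-cong {mkℚᵘ (+ suc k) (k ℕ.+ d ℕ.* suc k)} {mkℚᵘ (+ 1) d} (*≡*
    (trans (ℤ.*-comm (+ suc k) (+ suc d)) (sym (ℤ.*-identityˡ (+ suc d ℤ.* + suc k))))))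

Σ<-mono : ∀ k {f g} → (∀ j → j ℕ.< k → f j ℚ.≤ g j) → Σ< k f ℚ.≤ Σ< k g
Σ<-mono zero    h = ℚ.≤-refl
Σ<-mono (suc k) h = ℚ.+-mono-≤ (Σ<-mono k λ j j<k → h j (ℕ.m<n⇒m<1+n j<k)) (h k ℕ.≤-refl)

Σ<-cong : ∀ k {f g} → (∀ j → f j ≡ g j) → Σ< k f ≡ Σ< k g
Σ<-cong zero    h = refl
Σ<-cong (suc k) h = cong₂ ℚ._+_ (Σ<-cong k h) (h k)

Σ<-+ : ∀ a b f → Σ< (b ℕ.+ a) f ≡ Σ< a f ℚ.+ Σ< b (λ i → f (a ℕ.+ i))
Σ<-+ a zero    f = sym (ℚ.+-identityʳ (Σ< a f))
Σ<-+ a (suc b) f = trans (cong₂ ℚ._+_ (Σ<-+ a b f) (cong f (ℕ.+-comm b a)))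
  (ℚ.+-assoc (Σ< a f) (Σ< b (λ i → f (a ℕ.+ i))) (f (a ℕ.+ b)))

Σ<-* : ∀ a b f → Σ< (a ℕ.* b) f ≡ Σ< a (λ j → Σ< b (λ i → f (j ℕ.* b ℕ.+ i)))
Σ<-* zero    b f = refl
Σ<-* (suc a) b f = trans (Σ<-+ (a ℕ.* b) b f) (cong (ℚ._+ Σ< b (λ i → f (a ℕ.* b ℕ.+ i))) (Σ<-* a b f))

Σ<-shift : ∀ M k → Σ< k (λ j → unitFraction (M ℕ.+ j)) ℚ.+ unitFraction (M ℕ.+ k) ≡ Σ< k (λ j → unitFraction (suc M ℕ.+ j)) ℚ.+ unitFraction M
Σ<-shift M zero    = cong (0ℚ ℚ.+_) (cong unitFraction (ℕ.+-identityʳ M))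
Σ<-shift M (suc k) = trans (cong (ℚ._+ unitFraction (M ℕ.+ suc k)) (Σ<-shift M k))
  (trans (cong (Σ< k (λ j → unitFraction (suc M ℕ.+ j)) ℚ.+ unitFraction M ℚ.+_) (cong unitFraction (ℕ.+-suc M k)))
    (solve 3 (λ s a b → s :+ a :+ b := s :+ b :+ a) refl (Σ< k (λ j → unitFraction (suc M ℕ.+ j))) (unitFraction M) (unitFraction (suc M ℕ.+ k))))
  where open +-*-Solver

module _ (n M k : ℕ) where
  private
    K = suc k

    refine : riemann n (M ℕ.* K) ≡ Σ< (n ℕ.* M) (λ j → Σ< K (λ i → unitFraction (M ℕ.* K ℕ.+ (j ℕ.* K ℕ.+ i))))
    refine = trans (cong (λ l → Σ< l (λ j → unitFraction (M ℕ.* K ℕ.+ j))) (sym (ℕ.*-assoc n M K)))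
                   (Σ<-* (n ℕ.* M) K (λ j → unitFraction (M ℕ.* K ℕ.+ j)))

    index : ∀ j i → M ℕ.* K ℕ.+ (j ℕ.* K ℕ.+ i) ≡ i ℕ.+ (M ℕ.+ j) ℕ.* K
    index j i = solve 4 (λ M j K i → M :* K :+ (j :* K :+ i) := i :+ (M :+ j) :* K) refl M j K i
      where open ℕ-Solver

  riemann-lower : riemann n M ℚ.≤ riemann n (M ℕ.* K)
  riemann-lower = subst (riemann n M ℚ.≤_) (sym refine) (Σ<-mono (n ℕ.* M) λ j _ →
    subst (ℚ._≤ Σ< K (λ i → unitFraction (M ℕ.* K ℕ.+ (j ℕ.* K ℕ.+ i)))) (Σ<-block k (M ℕ.+ j))
      (Σ<-mono K λ i i<K → unitFraction-anti (subst (ℕ._≤ k ℕ.+ (M ℕ.+ j) ℕ.* K) (sym (index j i))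
        (ℕ.+-monoˡ-≤ ((M ℕ.+ j) ℕ.* K) (ℕ.s≤s⁻¹ i<K)))))

riemann-upper : ∀ n m k → riemann n (suc m ℕ.* suc k) ℚ.≤ riemann n (suc m) ℚ.+ unitFraction m
riemann-upper n m k = begin
  riemann n (suc m ℕ.* suc k)                                     ≡⟨ trans (cong (λ l → Σ< l f) (sym (ℕ.*-assoc n (suc m) (suc k)))) (Σ<-* t (suc k) f) ⟩
  Σ< t (λ j → Σ< (suc k) (λ i → f (j ℕ.* suc k ℕ.+ i)))            ≤⟨ Σ<-mono t (λ j _ → Σ<-mono (suc k) λ i _ → unitFraction-anti (index j i)) ⟩
  Σ< t (λ j → Σ< (suc k) (λ _ → unitFraction (k ℕ.+ (m ℕ.+ j) ℕ.* suc k)))    ≡⟨ Σ<-cong t (λ j → Σ<-block k (m ℕ.+ j)) ⟩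
  Σ< t (λ j → unitFraction (m ℕ.+ j))                                         ≡⟨ ℚ.+-identityʳ _ ⟨
  Σ< t (λ j → unitFraction (m ℕ.+ j)) ℚ.+ 0ℚ                                  ≤⟨ ℚ.+-monoʳ-≤ (Σ< t (λ j → unitFraction (m ℕ.+ j))) (ℚ.nonNegative⁻¹ (unitFraction (m ℕ.+ t)) {{ℚ.normalize-nonNeg 1 (suc (m ℕ.+ t))}}) ⟩
  Σ< t (λ j → unitFraction (m ℕ.+ j)) ℚ.+ unitFraction (m ℕ.+ t)                         ≡⟨ Σ<-shift m t ⟩
  riemann n (suc m) ℚ.+ unitFraction m                                       ∎
  where
  open ℚ.≤-Reasoning
  t = n ℕ.* suc m
  f = λ j → unitFraction (suc m ℕ.* suc k ℕ.+ j)
  index : ∀ j i → k ℕ.+ (m ℕ.+ j) ℕ.* suc k ℕ.≤ suc m ℕ.* suc k ℕ.+ (j ℕ.* suc k ℕ.+ i)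
  index j i = ℕ.≤-trans (ℕ.m≤m+n _ (suc i)) (ℕ.≤-reflexive
    (solve 4 (λ m j k i → k :+ (m :+ j) :* (con 1 :+ k) :+ (con 1 :+ i) := (con 1 :+ m) :* (con 1 :+ k) :+ (j :* (con 1 :+ k) :+ i)) refl m j k i))
    where open ℕ-Solver

riemann-close : ∀ n m k → riemann n (suc m) ℚ.- riemann n (suc k) ℚ.≤ unitFraction k
riemann-close n m k = ≤⇒-≤ {q = riemann n (suc k)} (ℚ.≤-trans (riemann-lower n (suc m) k)
  (subst (λ l → riemann n l ℚ.≤ riemann n (suc k) ℚ.+ unitFraction k) (ℕ.*-comm (suc k) (suc m)) (riemann-upper n k m)))

-- The natural logarithm as ∫₁ⁿ dt/t; the m-th approximation has mesh 1/(m+1).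
log : (n : ℕ) .{{_ : ℕ.NonZero n}} → ℝ
log (suc n) .seq m = riemann n (suc m)
log (suc n) .cauchy ε ε>0 = let N , h = archimedean ε ε>0 in N , λ m k N≤m N≤k →
  ∣p-q∣≤ {riemann n (suc m)} {riemann n (suc k)}
    (ℚ.≤-trans (riemann-close n m k) (ℚ.≤-trans (unitFraction-anti N≤k) h))
    (ℚ.≤-trans (riemann-close n k m) (ℚ.≤-trans (unitFraction-anti N≤m) h))

TendsToZero : (ℕ → ℝ) → Set
TendsToZero δ = ∀ ε → 0ℚ ℚ.< ε → ∃ λ N → ∀ n → N ℕ.≤ n → ∣ δ n ∣ ≤ fromℚ ε

{-# OPTIONS --safe #-}
module Submission where

-- Lower bound: ρ covers only the n + 1 permutations obtained by deleting one of
-- its letters, so n! ≤ (n + 1) κ n.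
--
-- Upper bound: every π is covered by d ≥ n² permutations ρ out of M = (n + 1)!.
-- Cover greedily in phases g = n, n - 1, …, 0, where phase g picks permutations
-- covering more than g of the x permutations still uncovered.  When phase g ends,
-- double counting gives x d ≤ M g, so replacing the weight 1/(g + 1) of an uncovered
-- permutation by 1/g costs at most M / (d (g + 1)).  In total
-- κ n ≤ n!/(n + 1) + (M/d) (H (n + 1) - 1), and L = H n - 1 ≤ log n.
-- Since L ≥ ⌊log₂ n⌋/2, the resulting factor (L + 2)/L is at most 1 + 4/⌊log₂ n⌋.

open import Defs
open import Data.Integer.Base using (+_)
open import Data.Nat.Base as ℕ using (ℕ; suc; NonZero; _^_; _!)
open import Data.Nat.Properties using (m^n≢0)
open import Data.Product.Base using (∃; _×_)
open import Data.Rational.Base using (_/_)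

import Algebra.Properties.CommutativeSemigroup as CommutativeSemigroup
open import Data.Fin.Base as Fin using (Fin; zero; suc; punchIn; punchOut; inject₁)
open import Data.Fin.Permutation using (Permutation′; _⟨$⟩ʳ_; _⟨$⟩ˡ_; _≈_; insert; remove; insert-punchIn; punchIn-permute; inverseˡ; inverseʳ)
import Data.Fin.Properties as Fin
import Data.Integer.Base as ℤ
import Data.Integer.Properties as ℤ
open import Data.List.Base using (List; []; _∷_; _++_; map; length; lookup; filter; deduplicate; allFin; cartesianProductWith)
open import Data.List.Membership.Propositional using (_∈_; find)
open import Data.List.Membership.Propositional.Properties using (∈-allFin; ∈-filter⁻; ∈-filter⁺; ∈-lookup)
import Data.List.Membership.Setoid.Properties as Membership
open import Data.List.Properties using (length-++; length-map; length-tabulate; length-deduplicate; filter-some)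
open import Data.List.Relation.Unary.All as All using ([]; _∷_)
import Data.List.Relation.Unary.All.Properties as All
open import Data.List.Relation.Unary.AllPairs using ([]; _∷_)
open import Data.List.Relation.Unary.Any as Any using (Any; here; there)
import Data.List.Relation.Unary.Any.Properties as Any
open import Data.List.Relation.Unary.Unique.DecSetoid.Properties using (deduplicate-!)
open import Data.List.Relation.Unary.Unique.Propositional.Properties using (allFin⁺)
open import Data.List.Relation.Unary.Unique.Setoid using (Unique)
import Data.List.Relation.Unary.Unique.Setoid.Properties as Unique
open import Data.Nat.Base using (zero; z≤n; s≤s)
open import Data.Nat.Induction using (Acc; acc; <-wellFounded)
open import Data.Nat.ListAction using (sum)
open import Data.Nat.Logarithm using (⌊log₂_⌋; ⌊log₂⌋-mono-≤; ⌊log₂[2^n]⌋≡n)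
open import Data.Nat.Logarithm.Core using (⌊log2⌋)
import Data.Nat.Properties as ℕ
open import Data.Nat.Solver using () renaming (module +-*-Solver to ℕ-Solver)
open import Data.Product.Base using (_,_; proj₁; proj₂)
open import Data.Rational.Base as ℚ using (ℚ; 0ℚ; 1ℚ; ½; nonNegative)
import Data.Rational.Properties as ℚ
open import Data.Rational.Solver using (module +-*-Solver)
open import Data.Rational.Unnormalised.Base using (_≃_; mkℚᵘ; *≡*; *≤*)
import Data.Rational.Unnormalised.Properties as ℚᵘ
open import Data.Sum.Base as Sum using (_⊎_; inj₁; inj₂; [_,_]′)
open import Function.Base using (_∘_)
open import Function.Bundles using (mk⇔; Equivalence)
open import Level using (Level)
open import Relation.Binary.Bundles using (Setoid; DecSetoid)
open import Relation.Binary.Definitions using (tri<; tri≈; tri>)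
open import Relation.Binary.PropositionalEquality using (_≡_; _≢_; refl; sym; trans; cong; cong₂; subst; subst₂; setoid; module ≡-Reasoning)
open import Relation.Nullary.Decidable using (Dec; yes; no; ¬?)
open import Relation.Nullary.Negation using (¬_; contradiction)

open CommutativeSemigroup ℕ.+-commutativeSemigroup using (x∙yz≈y∙xz)

private variable
  a ℓ : Level

-- Lengths of lists without repetition.

module _ (T : Setoid a ℓ) where
  private module T = Setoid T
  open import Data.List.Membership.Setoid T using () renaming (_∈_ to _∈ₜ_)

  lookup-injective : ∀ {xs} → Unique T xs → ∀ i j → lookup xs i T.≈ lookup xs j → i ≡ j
  lookup-injective (x≉ ∷ xs!) zero    zero    e = refl
  lookup-injective (x≉ ∷ xs!) zero    (suc j) e = contradiction e (All.lookup x≉ (∈-lookup j))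
  lookup-injective (x≉ ∷ xs!) (suc i) zero    e = contradiction (T.sym e) (All.lookup x≉ (∈-lookup i))
  lookup-injective (x≉ ∷ xs!) (suc i) (suc j) e = cong suc (lookup-injective xs! i j e)

  -- Sending each position of `xs` to the index of its entry in `ys` is injective. The hypothesis
  -- takes propositional membership in `xs`, so a predicate that filters `xs` can be read off
  -- without respecting ≈.
  unique-⊆⇒length-≤ : ∀ {xs ys} → Unique T xs → (∀ {x} → x ∈ xs → x ∈ₜ ys) → length xs ℕ.≤ length ys
  unique-⊆⇒length-≤ {xs} {ys} xs! xs⊆ys = Fin.injective⇒≤ {f = λ i → Any.index (xs⊆ys (∈-lookup {xs = xs} i))}
    λ {i} {j} e → lookup-injective xs! i j
      (Membership.index-injective T (xs⊆ys (∈-lookup i)) (xs⊆ys (∈-lookup j)) e)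

length-cartesianProductWith : ∀ {A B C : Set} (f : A → B → C) xs ys →
                              length (cartesianProductWith f xs ys) ≡ length xs ℕ.* length ys
length-cartesianProductWith f []       ys = refl
length-cartesianProductWith f (x ∷ xs) ys = trans (length-++ (map (f x) ys))
  (cong₂ ℕ._+_ (length-map (f x) ys) (length-cartesianProductWith f xs ys))

length-allFin : ∀ n → length (allFin n) ≡ n
length-allFin n = length-tabulate {n = n} _

-- Double counting for a decidable relation.

module _ {A B : Set} {R : A → B → Set} (R? : ∀ y x → Dec (R y x)) where

  count : A → List B → ℕ
  count y xs = length (filter (R? y) xs)

  degree : List A → B → ℕ
  degree ys x = length (filter (λ y → R? y x) ys)

  sum-count-∷ : ∀ ys x xs → sum (map (λ y → count y (x ∷ xs)) ys) ≡ degree ys x ℕ.+ sum (map (λ y → count y xs) ys)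
  sum-count-∷ []       x xs = refl
  sum-count-∷ (y ∷ ys) x xs with R? y x
  ... | yes _ = cong suc (trans (cong (count y xs ℕ.+_) (sum-count-∷ ys x xs)) (x∙yz≈y∙xz (count y xs) (degree ys x) _))
  ... | no  _ = trans (cong (count y xs ℕ.+_) (sum-count-∷ ys x xs)) (x∙yz≈y∙xz (count y xs) (degree ys x) _)

  degree-≤⇒sum-count-≥ : ∀ d ys xs → (∀ {x} → x ∈ xs → d ℕ.≤ degree ys x) →
                         length xs ℕ.* d ℕ.≤ sum (map (λ y → count y xs) ys)
  degree-≤⇒sum-count-≥ d ys []       h = z≤n
  degree-≤⇒sum-count-≥ d ys (x ∷ xs) h = subst (d ℕ.+ length xs ℕ.* d ℕ.≤_) (sym (sum-count-∷ ys x xs))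
    (ℕ.+-mono-≤ (h (here refl)) (degree-≤⇒sum-count-≥ d ys xs (h ∘ there)))

  sum-count-≤ : ∀ g ys xs → (∀ {y} → y ∈ ys → count y xs ℕ.≤ g) → sum (map (λ y → count y xs) ys) ℕ.≤ length ys ℕ.* g
  sum-count-≤ g []       xs h = z≤n
  sum-count-≤ g (y ∷ ys) xs h = ℕ.+-mono-≤ (h (here refl)) (sum-count-≤ g ys xs (h ∘ there))

  -- The number of related pairs lies between the two sides: it is bounded below through the degrees
  -- of the `xs` and above through the counts of the `ys`.
  double-counting : ∀ {d g} ys xs → (∀ {x} → x ∈ xs → d ℕ.≤ degree ys x) → (∀ {y} → y ∈ ys → count y xs ℕ.≤ g) →
                    length xs ℕ.* d ℕ.≤ length ys ℕ.* g
  double-counting {d} {g} ys xs hx hy = ℕ.≤-trans (degree-≤⇒sum-count-≥ d ys xs hx) (sum-count-≤ g ys xs hy)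

  uncovered : A → List B → List B
  uncovered y = filter (λ x → ¬? (R? y x))

  length-uncovered : ∀ y xs → length (uncovered y xs) ℕ.+ count y xs ≡ length xs
  length-uncovered y []       = refl
  length-uncovered y (x ∷ xs) with R? y x
  ... | yes _ = trans (ℕ.+-suc _ _) (cong suc (length-uncovered y xs))
  ... | no  _ = cong suc (length-uncovered y xs)

-- Strictly monotone maps between finite ordinals.

StrictlyMonotone : ∀ {m n} → (Fin m → Fin n) → Set
StrictlyMonotone f = ∀ i j → i Fin.< j → f i Fin.< f j

module _ {m n} (f : Fin m → Fin (suc n)) (f-mono : StrictlyMonotone f) (0∉f : ∀ i → zero ≢ f i) where

  lower : Fin m → Fin n
  lower i = punchOut (0∉f i)

  suc-lower : ∀ i → suc (lower i) ≡ f i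
  suc-lower i = Fin.punchIn-punchOut (0∉f i)

  lower-mono : StrictlyMonotone lower
  lower-mono i j i<j = ℕ.s<s⁻¹ (subst₂ Fin._<_ (sym (suc-lower i)) (sym (suc-lower j)) (f-mono i j i<j))

module _ {m n} (f : Fin (suc m) → Fin (suc n)) (f-mono : StrictlyMonotone f) where

  mono⇒0∉tail : ∀ i → zero ≢ f (suc i)
  mono⇒0∉tail i e with () ← subst (f zero Fin.<_) (sym e) (f-mono zero (suc i) (s≤s z≤n))

  tail-mono : StrictlyMonotone (f ∘ suc)
  tail-mono i j = f-mono (suc i) (suc j) ∘ s≤s

  mono⇒0∉ : zero ≢ f zero → ∀ i → zero ≢ f i
  mono⇒0∉ e zero    = e
  mono⇒0∉ e (suc i) = mono⇒0∉tail i

-- The tail of `f` avoids zero, so lowering it gives a strictly monotone self-map of a smaller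
-- ordinal, the identity by induction. This leaves only zero as the value at zero.
mono⇒id : ∀ {n} (f : Fin n → Fin n) → StrictlyMonotone f → ∀ i → f i ≡ i
mono⇒id {suc n} f f-mono = λ { zero → f0≡0 (f zero) refl ; (suc i) → f-suc i }
  where
  0∉ = mono⇒0∉tail f f-mono
  f-suc : ∀ i → f (suc i) ≡ suc i
  f-suc i = trans (sym (suc-lower (f ∘ suc) (tail-mono f f-mono) 0∉ i))
    (cong suc (mono⇒id _ (lower-mono (f ∘ suc) (tail-mono f f-mono) 0∉) i))
  f0≡0 : ∀ k → f zero ≡ k → f zero ≡ zero
  f0≡0 zero    e = e
  -- Otherwise `f` would take the value `suc k` at both `zero` and `suc k`.
  f0≡0 (suc k) e = contradiction (f-mono zero (suc k) (s≤s z≤n)) (Fin.<-irrefl (trans e (sym (f-suc k))))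

-- Here `k` is the one value that `f` omits. If `f zero` is positive, zero is omitted and the
-- lowered map is the identity; otherwise the omitted value is found by lowering the tail.
mono⇒punchIn : ∀ {n} (f : Fin n → Fin (suc n)) → StrictlyMonotone f → ∃ λ k → ∀ i → f i ≡ punchIn k i
mono⇒punchIn {zero}  f f-mono = zero , λ ()
mono⇒punchIn {suc n} f f-mono with zero Fin.≟ f zero
... | no 0≢f0 = zero , λ i → trans (sym (suc-lower f f-mono (mono⇒0∉ f f-mono 0≢f0) i))
  (cong suc (mono⇒id _ (lower-mono f f-mono (mono⇒0∉ f f-mono 0≢f0)) i))
... | yes 0≡f0 =
  let 0∉ = mono⇒0∉tail f f-mono
      k , e = mono⇒punchIn _ (lower-mono (f ∘ suc) (tail-mono f f-mono) 0∉)
  in suc k , λ { zero    → sym 0≡f0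
               ; (suc i) → trans (sym (suc-lower (f ∘ suc) (tail-mono f f-mono) 0∉ i)) (cong suc (e i)) }

-- Covering as deletion and insertion of one letter.

punchIn-mono-< : ∀ {n} (k : Fin (suc n)) {i j} → i Fin.< j → punchIn k i Fin.< punchIn k j
punchIn-mono-< k {i} {j} i<j = ℕ.≰⇒> (ℕ.<⇒≱ i<j ∘ Fin.punchIn-cancel-≤ k j i)

punchIn-cancel-< : ∀ {n} (k : Fin (suc n)) {i j} → punchIn k i Fin.< punchIn k j → i Fin.< j
punchIn-cancel-< k {i} {j} h = ℕ.≰⇒> (ℕ.<⇒≱ h ∘ Fin.punchIn-mono-≤ k j i)

-- The composite of `σ` with the inverse of `π` is strictly monotone, hence the identity.
order-iso⇒≈ : ∀ {n} (π σ : Permutation′ n) →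
              (∀ i j → π ⟨$⟩ʳ i Fin.< π ⟨$⟩ʳ j → σ ⟨$⟩ʳ i Fin.< σ ⟨$⟩ʳ j) → π ≈ σ
order-iso⇒≈ π σ h i = sym (trans (cong (σ ⟨$⟩ʳ_) (sym (inverseˡ π)))
  (mono⇒id (λ k → σ ⟨$⟩ʳ (π ⟨$⟩ˡ k))
    (λ k l k<l → h (π ⟨$⟩ˡ k) (π ⟨$⟩ˡ l) (subst₂ Fin._<_ (sym (inverseʳ π)) (sym (inverseʳ π)) k<l)) (π ⟨$⟩ʳ i)))

-- The embedding of positions is `punchIn k` for the position `k` it omits, so `π` is ordered like
-- `ρ` with the letter at `k` deleted.
covers⇒remove : ∀ {n} (ρ : Permutation′ (suc n)) π → ρ Covers π → ∃ λ k → π ≈ remove k ρ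
covers⇒remove ρ π (f , f-mono , iso) =
  let k , e = mono⇒punchIn f f-mono
  in k , order-iso⇒≈ π (remove k ρ) λ i j πi<πj → punchIn-cancel-< (ρ ⟨$⟩ʳ k)
       (subst₂ Fin._<_ (trans (cong (ρ ⟨$⟩ʳ_) (e i)) (punchIn-permute ρ k i))
                       (trans (cong (ρ ⟨$⟩ʳ_) (e j)) (punchIn-permute ρ k j))
                       (Equivalence.to (iso i j) πi<πj))

insert-covers : ∀ {n} (i j : Fin (suc n)) (π : Permutation′ n) → insert i j π Covers π
insert-covers i j π = punchIn i , (λ _ _ → punchIn-mono-< i) , λ k l → mk⇔
  (λ h → subst₂ Fin._<_ (sym (insert-punchIn i j π k)) (sym (insert-punchIn i j π l)) (punchIn-mono-< j h))
  (λ h → punchIn-cancel-< j (subst₂ Fin._<_ (insert-punchIn i j π k) (insert-punchIn i j π l) h))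

insert-at : ∀ {n} (i j : Fin (suc n)) (π : Permutation′ n) → insert i j π ⟨$⟩ʳ i ≡ j
insert-at i j π with i Fin.≟ i
... | yes _  = refl
... | no i≢i = contradiction refl i≢i

insert-injective : ∀ {n} (i : Fin (suc n)) {j k} {π ρ : Permutation′ n} → insert i j π ≈ insert i k ρ → j ≡ k × π ≈ ρ
insert-injective i {j} {k} {π} {ρ} e = j≡k , λ l → Fin.punchIn-injective j _ _
  (trans (sym (insert-punchIn i j π l)) (trans (e (punchIn i l))
    (trans (insert-punchIn i k ρ l) (cong (λ m → punchIn m (ρ ⟨$⟩ʳ l)) (sym j≡k)))))
  where
  j≡k : j ≡ k
  j≡k = trans (sym (insert-at i j π)) (trans (e i) (insert-at i k ρ))

-- Counting all permutations, and those covered by one `ρ`.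

permutations-unique : ∀ n → Unique (S n) (permutations n)
permutations-unique zero    = [] ∷ []
permutations-unique (suc n) = Unique.cartesianProductWith⁺ (Fin.≡-setoid (suc n)) (S n) (S (suc n)) (insert zero)
  (λ {i} {j} {π} {ρ} → insert-injective zero {i} {j} {π} {ρ})
  (allFin⁺ (suc n)) (permutations-unique n)

length-permutations : ∀ n → length (permutations n) ≡ n !
length-permutations zero    = refl
length-permutations (suc n) = trans (length-cartesianProductWith (insert zero) (allFin (suc n)) (permutations n))
  (cong₂ ℕ._*_ (length-allFin (suc n)) (length-permutations n))

count-covers-≤ : ∀ {n} (ρ : Permutation′ (suc n)) → count contains? ρ (permutations n) ℕ.≤ suc n
count-covers-≤ {n} ρ = subst (count contains? ρ (permutations n) ℕ.≤_) (trans (length-map _ (allFin (suc n))) (length-allFin (suc n)))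
  (unique-⊆⇒length-≤ (S n) {ys = map (λ k → remove k ρ) (allFin (suc n))}
    (Unique.filter⁺ (S n) (contains? ρ) (permutations-unique n))
    λ {π} π∈ →
      let k , e = covers⇒remove ρ π (proj₂ (∈-filter⁻ (contains? ρ) {xs = permutations n} π∈))
      in Any.map⁺ {f = λ i → remove i ρ} (Any.map (λ k≡i l → trans (e l) (cong (λ i → remove i ρ ⟨$⟩ʳ l) k≡i)) (∈-allFin k)))

-- Permutations that cover a given `π`.

-- Read for values: inserting the letter `j` turns an old letter into one of two candidates, exactly
-- the two that `nonadjacent` avoids.
punchIn-cases : ∀ {n} (j : Fin (suc n)) k → punchIn j k ≡ inject₁ k ⊎ punchIn j k ≡ suc k
punchIn-cases zero    k       = inj₂ refl
punchIn-cases (suc j) zero    = inj₁ refl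
punchIn-cases (suc j) (suc k) = Sum.map (cong suc) (cong suc) (punchIn-cases j k)

punchIn-> : ∀ {n} (j : Fin (suc n)) k → inject₁ k Fin.< j → punchIn j k ≡ inject₁ k
punchIn-> (suc j) zero    h = refl
punchIn-> (suc j) (suc k) h = cong suc (punchIn-> j k (ℕ.s<s⁻¹ h))

-- If a letter inserted immediately to the left of a is not adjacent in value to a,
-- no insertion further to the right yields the same word.
nonadjacent : ∀ {n} → Fin (suc n) → Fin n → Fin (suc (suc n))
nonadjacent a k = punchIn (suc a) (punchIn a k)

nonadjacent-injective : ∀ {n} (a : Fin (suc n)) {k l : Fin n} → nonadjacent a k ≡ nonadjacent a l → k ≡ l
nonadjacent-injective a = Fin.punchIn-injective a _ _ ∘ Fin.punchIn-injective (suc a) _ _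

nonadjacent-≢suc : ∀ {n} (a : Fin (suc n)) (k : Fin n) → nonadjacent a k ≢ suc a
nonadjacent-≢suc a k = Fin.punchInᵢ≢i (suc a) (punchIn a k)

nonadjacent-≢inject₁ : ∀ {n} (a : Fin (suc n)) (k : Fin n) → nonadjacent a k ≢ inject₁ a
nonadjacent-≢inject₁ a k e = Fin.punchInᵢ≢i a k
  (Fin.punchIn-injective (suc a) _ _ (trans e (sym (punchIn-> (suc a) a (s≤s (ℕ.≤-reflexive (Fin.toℕ-inject₁ a)))))))

module _ {n} (π : Permutation′ (suc n)) where

  insertLeft : Fin (suc n) → Fin n → Permutation′ (suc (suc n))
  insertLeft i k = insert (inject₁ i) (nonadjacent (π ⟨$⟩ʳ i) k) π

  -- Compare the letters at position `inject₁ i`. The second word still has the old letter `π i`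
  -- there, raised by at most one, while the first has a nonadjacent letter.
  insertLeft-≉ : ∀ i k i′ j → inject₁ i Fin.< i′ → ¬ insertLeft i k ≈ insert i′ j π
  insertLeft-≉ i k i′ j i<i′ e =
    [ nonadjacent-≢inject₁ (π ⟨$⟩ʳ i) k ∘ trans eq , nonadjacent-≢suc (π ⟨$⟩ʳ i) k ∘ trans eq ]′
      (punchIn-cases j (π ⟨$⟩ʳ i))
    where
    eq : nonadjacent (π ⟨$⟩ʳ i) k ≡ punchIn j (π ⟨$⟩ʳ i)
    eq = trans (sym (insert-at (inject₁ i) _ π)) (trans (e (inject₁ i))
      (trans (cong (insert i′ j π ⟨$⟩ʳ_) (sym (punchIn-> i′ i i<i′))) (insert-punchIn i′ j π i)))

  insertLeft-injective : ∀ {i i′ k k′} → insertLeft i k ≈ insertLeft i′ k′ → i ≡ i′ × k ≡ k′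
  insertLeft-injective {i} {i′} {k} {k′} e with Fin.<-cmp (inject₁ i) (inject₁ i′)
  ... | tri< i<i′ _ _ = contradiction e (insertLeft-≉ i k (inject₁ i′) _ i<i′)
  ... | tri> _ _ i′<i = contradiction (λ l → sym (e l)) (insertLeft-≉ i′ k′ (inject₁ i) _ i′<i)
  ... | tri≈ _ i≡i′ _ with refl ← Fin.inject₁-injective i≡i′ =
    refl , nonadjacent-injective (π ⟨$⟩ʳ i) (proj₁ (insert-injective (inject₁ i) {π = π} {π} e))

  insertLast : Fin (suc (suc n)) → Permutation′ (suc (suc n))
  insertLast j = insert (Fin.fromℕ (suc n)) j π

  -- For `π` of length n + 1 there are n nonadjacent letters to the left of each of its n + 1
  -- letters, and n + 2 choices at the end.
  extensions : List (Permutation′ (suc (suc n)))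
  extensions = cartesianProductWith insertLeft (allFin (suc n)) (allFin n) ++ map insertLast (allFin (suc (suc n)))

  private
    S₂ = S (suc (suc n))

  extensions-unique : Unique S₂ extensions
  extensions-unique = Unique.++⁺ S₂
    (Unique.cartesianProductWith⁺ (Fin.≡-setoid _) (Fin.≡-setoid _) S₂ insertLeft
      (λ {i} {i′} {k} {k′} → insertLeft-injective {i} {i′} {k} {k′})
      (allFin⁺ (suc n)) (allFin⁺ n))
    (Unique.map⁺ (Fin.≡-setoid _) S₂ (λ {j} {k} e → proj₁ (insert-injective (Fin.fromℕ (suc n)) {j} {k} {π} {π} e)) (allFin⁺ (suc (suc n))))
    -- The end lies to the right of every `inject₁ i`, so `insertLeft-≉` also separates the two
    -- lists.
    λ {ρ} (p , q) →
      let i , k , _ , _ , e = Membership.∈-cartesianProductWith⁻ (Fin.≡-setoid _) (Fin.≡-setoid _) S₂ insertLeft (allFin (suc n)) (allFin n) {ρ} p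
          j , _ , d = Membership.∈-map⁻ (Fin.≡-setoid _) S₂ {v = ρ} {xs = allFin (suc (suc n))} {f = insertLast} q
      in insertLeft-≉ i k (Fin.fromℕ (suc n)) j (s≤s (subst (ℕ._≤ Fin.toℕ (Fin.fromℕ n)) (sym (Fin.toℕ-inject₁ i)) (Fin.≤fromℕ i)))
           (λ l → trans (sym (e l)) (d l))

  extensions-cover : ∀ {ρ} → ρ ∈ extensions → ρ Covers π
  extensions-cover {ρ} ρ∈ with Membership.∈-++⁻ (setoid _) (cartesianProductWith insertLeft (allFin (suc n)) (allFin n)) ρ∈
  ... | inj₁ p with Membership.∈-cartesianProductWith⁻ (Fin.≡-setoid _) (Fin.≡-setoid _) (setoid _) insertLeft (allFin (suc n)) (allFin n) p
  ...   | i , k , _ , _ , refl = insert-covers (inject₁ i) _ π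
  extensions-cover {ρ} ρ∈ | inj₂ p with Membership.∈-map⁻ (Fin.≡-setoid _) (setoid _) {xs = allFin (suc (suc n))} {f = insertLast} p
  ...   | j , _ , refl = insert-covers (Fin.fromℕ (suc n)) j π

  length-extensions : length extensions ≡ suc n ℕ.* n ℕ.+ suc (suc n)
  length-extensions = trans (length-++ (cartesianProductWith insertLeft (allFin (suc n)) (allFin n)))
    (cong₂ ℕ._+_ (trans (length-cartesianProductWith insertLeft (allFin (suc n)) (allFin n)) (cong₂ ℕ._*_ (length-allFin (suc n)) (length-allFin n)))
               (trans (length-map insertLast (allFin (suc (suc n)))) (length-allFin (suc (suc n)))))

  degree-covers-≥ : suc n ^ 2 ℕ.≤ degree contains? (permutations (suc (suc n))) π
  degree-covers-≥ = ℕ.≤-trans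
    -- There are (n + 1)² + 1 extensions; the surplus one is given away.
    (ℕ.≤-trans (ℕ.n≤1+n _) (ℕ.≤-reflexive (trans (square n) (sym length-extensions))))
    (unique-⊆⇒length-≤ S₂ extensions-unique λ {ρ} ρ∈ →
      Membership.∈-filter⁺ S₂ (λ σ → contains? σ π)
        (λ {σ} {τ} e → Contains-resp {ρ = σ} {τ} {π} {π} e (λ _ → refl))
        {v = ρ} {xs = permutations (suc (suc n))} (permutations-enumerate (suc (suc n)) ρ) (extensions-cover ρ∈))
    where
    open ℕ-Solver
    square : ∀ n → suc (suc n ^ 2) ≡ suc n ℕ.* n ℕ.+ suc (suc n)
    square = solve 1 (λ n → con 1 :+ (con 1 :+ n) :^ 2 := (con 1 :+ n) :* n :+ (con 2 :+ n)) refl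

-- Minimality of `κ` and the counting lower bound.

-- Deduplication keeps a list covering and does not lengthen it, so a list built greedily may be
-- compared with `κ n` whether or not it repeats entries.
κ-minimal : ∀ {n} (A : List (Permutation′ (suc n))) → CoversAll A → κ n ℕ.≤ length A
κ-minimal {n} A c = ℕ.≤-trans
  (proj₂ (proj₂ (smallest-covering n)) _ (A′ , deduplicate-! (S-dec (suc n)) A , refl , c′))
  (length-deduplicate _≟_ A)
  where
  open DecSetoid (S-dec (suc n)) using (_≟_)
  A′ = deduplicate _≟_ A
  c′ : CoversAll A′
  c′ π = Any.deduplicate⁺ _≟_ (λ {σ} {ρ} e → Contains-resp {ρ = σ} {ρ} {π} {π} (λ i → sym (e i)) (λ _ → refl)) (c π)

κ-lower : ∀ n → n ! ℕ.≤ κ n ℕ.* suc n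
κ-lower n =
  let k , (A , _ , len , c) , _ = smallest-covering n
  in subst₂ ℕ._≤_ (trans (ℕ.*-identityʳ _) (length-permutations n)) (cong (ℕ._* suc n) len)
    -- Degrees are at least 1 because `A` covers, and counts are at most n + 1.
    (double-counting contains? A (permutations n)
      (λ {π} _ → filter-some (λ ρ → contains? ρ π) (c π)) (λ {ρ} _ → count-covers-≤ ρ))

-- Naturals and unit fractions in the rationals.

ι : ℕ → ℚ
ι n = + n / 1

private
  toℚᵘ-ι : ∀ n → ℚ.toℚᵘ (ι n) ≃ mkℚᵘ (+ n) 0
  toℚᵘ-ι n = ℚ.toℚᵘ-fromℚᵘ (mkℚᵘ (+ n) 0)

ι-+ : ∀ m n → ι (m ℕ.+ n) ≡ ι m ℚ.+ ι n
ι-+ m n = ℚ.toℚᵘ-injective (ℚᵘ.≃-trans (toℚᵘ-ι (m ℕ.+ n)) (ℚᵘ.≃-sym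
  (ℚᵘ.≃-trans (ℚ.toℚᵘ-homo-+ (ι m) (ι n)) (ℚᵘ.≃-trans (ℚᵘ.+-cong (toℚᵘ-ι m) (toℚᵘ-ι n))
    (*≡* (cong (ℤ._* + 1) (cong₂ ℤ._+_ (ℤ.*-identityʳ (+ m)) (ℤ.*-identityʳ (+ n)))))))))

ι-* : ∀ m n → ι (m ℕ.* n) ≡ ι m ℚ.* ι n
ι-* m n = ℚ.toℚᵘ-injective (ℚᵘ.≃-trans (toℚᵘ-ι (m ℕ.* n)) (ℚᵘ.≃-sym
  (ℚᵘ.≃-trans (ℚ.toℚᵘ-homo-* (ι m) (ι n)) (ℚᵘ.≃-trans (ℚᵘ.*-cong (toℚᵘ-ι m) (toℚᵘ-ι n))
    (*≡* (cong (ℤ._* + 1) (sym (ℤ.pos-* m n))))))))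

ι-mono : ∀ {m n} → m ℕ.≤ n → ι m ℚ.≤ ι n
ι-mono {m} {n} h = ℚ.toℚᵘ-cancel-≤ (ℚᵘ.≤-respˡ-≃ (ℚᵘ.≃-sym (toℚᵘ-ι m)) (ℚᵘ.≤-respʳ-≃ (ℚᵘ.≃-sym (toℚᵘ-ι n))
  (*≤* (ℤ.*-monoʳ-≤-nonNeg (+ 1) (ℤ.+≤+ h)))))

ι≥0 : ∀ n → 0ℚ ℚ.≤ ι n
ι≥0 n = ι-mono {0} {n} z≤n

unitFraction≥0 : ∀ n → 0ℚ ℚ.≤ unitFraction n
unitFraction≥0 n = ℚ.nonNegative⁻¹ (unitFraction n) {{ℚ.normalize-nonNeg 1 (suc n)}}

/≡ι*1/ : ∀ m n .{{_ : NonZero n}} → + m / n ≡ ι m ℚ.* (+ 1 / n)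
/≡ι*1/ m n@(suc n′) = ℚ.toℚᵘ-injective (ℚᵘ.≃-trans (ℚ.toℚᵘ-fromℚᵘ (mkℚᵘ (+ m) n′)) (ℚᵘ.≃-sym
  (ℚᵘ.≃-trans (ℚ.toℚᵘ-homo-* (ι m) (unitFraction n′))
    (ℚᵘ.≃-trans (ℚᵘ.*-cong (toℚᵘ-ι m) (ℚ.toℚᵘ-fromℚᵘ (mkℚᵘ (+ 1) n′)))
      (*≡* (cong₂ ℤ._*_ (ℤ.*-identityʳ (+ m)) (cong +_ (sym (ℕ.+-identityʳ n)))))))))

ι*1/≡1 : ∀ n .{{_ : NonZero n}} → ι n ℚ.* (+ 1 / n) ≡ 1ℚ
ι*1/≡1 n@(suc n′) = trans (sym (/≡ι*1/ n n)) (ℚ.fromℚᵘ-cong {mkℚᵘ (+ n) n′} {mkℚᵘ (+ 1) 0} (*≡* (ℤ.*-comm (+ n) (+ 1))))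

1/≥0 : ∀ n .{{_ : NonZero n}} → 0ℚ ℚ.≤ + 1 / n
1/≥0 (suc n) = unitFraction≥0 n

*-monoˡ : ∀ {p q r} → 0ℚ ℚ.≤ p → q ℚ.≤ r → p ℚ.* q ℚ.≤ p ℚ.* r
*-monoˡ {p} 0≤p = ℚ.*-monoˡ-≤-nonNeg p {{nonNegative 0≤p}}

*-monoʳ : ∀ {p q r} → 0ℚ ℚ.≤ p → q ℚ.≤ r → q ℚ.* p ℚ.≤ r ℚ.* p
*-monoʳ {p} 0≤p = ℚ.*-monoʳ-≤-nonNeg p {{nonNegative 0≤p}}

*-nonNeg : ∀ {p q} → 0ℚ ℚ.≤ p → 0ℚ ℚ.≤ q → 0ℚ ℚ.≤ p ℚ.* q
*-nonNeg {p} {q} 0≤p 0≤q = subst (ℚ._≤ p ℚ.* q) (ℚ.*-zeroʳ p) (*-monoˡ 0≤p 0≤q)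

p≤p+q : ∀ {p q} → 0ℚ ℚ.≤ q → p ℚ.≤ p ℚ.+ q
p≤p+q {p} {q} 0≤q = subst (ℚ._≤ p ℚ.+ q) (ℚ.+-identityʳ p) (ℚ.+-monoʳ-≤ p 0≤q)

-- Telescoping and harmonic sums.

-- The identity 1/(n + 1) - 1/(n + 2) = 1/((n + 1)(n + 2)) measures the change of weight when the
-- greedy level drops by one.
unitFraction-split : ∀ n → unitFraction n ≡ unitFraction (suc n) ℚ.+ unitFraction n ℚ.* unitFraction (suc n)
unitFraction-split n = begin
  u                         ≡⟨ ℚ.*-identityʳ u ⟨
  u ℚ.* 1ℚ                  ≡⟨ cong (u ℚ.*_) (trans (cong (ℚ._* v) (sym (ι-+ 1 (suc n)))) (ι*1/≡1 (suc (suc n)))) ⟨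
  u ℚ.* ((1ℚ ℚ.+ i) ℚ.* v)  ≡⟨ solve 3 (λ u i v → u :* ((con 1ℚ :+ i) :* v) := i :* u :* v :+ u :* v) refl u i v ⟩
  i ℚ.* u ℚ.* v ℚ.+ u ℚ.* v ≡⟨ cong (λ x → x ℚ.* v ℚ.+ u ℚ.* v) (ι*1/≡1 (suc n)) ⟩
  1ℚ ℚ.* v ℚ.+ u ℚ.* v      ≡⟨ cong (ℚ._+ u ℚ.* v) (ℚ.*-identityˡ v) ⟩
  v ℚ.+ u ℚ.* v             ∎
  where
  open ≡-Reasoning
  open +-*-Solver
  u = unitFraction n
  v = unitFraction (suc n)
  i = ι (suc n)

-- H (g + 1) − 1, the shift that makes it a lower Riemann sum of the logarithm.
harmonic : ℕ → ℚ
harmonic g = Σ< g (λ j → unitFraction (suc j))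

Σ<-nonNeg : ∀ k {f} → (∀ j → 0ℚ ℚ.≤ f j) → 0ℚ ℚ.≤ Σ< k f
Σ<-nonNeg zero    h = ℚ.≤-refl
Σ<-nonNeg (suc k) h = ℚ.+-mono-≤ (Σ<-nonNeg k h) (h k)

harmonic≥0 : ∀ g → 0ℚ ℚ.≤ harmonic g
harmonic≥0 g = Σ<-nonNeg g (unitFraction≥0 ∘ suc)

harmonic-mono : ∀ {m n} → m ℕ.≤ n → harmonic m ℚ.≤ harmonic n
harmonic-mono {m} {n} m≤n = subst (λ k → harmonic m ℚ.≤ harmonic k) (ℕ.m∸n+n≡m m≤n)
  (subst (harmonic m ℚ.≤_) (sym (Σ<-+ m (n ℕ.∸ m) _)) (p≤p+q (Σ<-nonNeg (n ℕ.∸ m) λ j → unitFraction≥0 (suc (m ℕ.+ j)))))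

-- Greedy covering in phases.

module _ {A B : Set} {R : A → B → Set} (R? : ∀ y x → Dec (R y x)) (ys : List A) (d : ℕ) .{{_ : NonZero d}} where

  -- At level g a y is picked as long as it covers more than g of the remaining xs,
  -- then g decreases; m only bounds the recursion.
  greedy : ∀ g m xs → length xs ℕ.≤ m → (∀ {x} → x ∈ xs → d ℕ.≤ degree R? ys x) →
           ∃ λ zs → (∀ {x} → x ∈ xs → Any (λ z → R z x) zs) ×
                    ι (length zs) ℚ.* ι d ℚ.≤ ι (length xs) ℚ.* ι d ℚ.* unitFraction g ℚ.+ ι (length ys) ℚ.* harmonic g
  greedy g m [] _ deg = [] , (λ ()) , subst₂ ℚ._≤_ (sym (ℚ.*-zeroˡ (ι d)))
    (sym (trans (cong (ℚ._+ ι (length ys) ℚ.* harmonic g) (trans (cong (ℚ._* unitFraction g) (ℚ.*-zeroˡ (ι d))) (ℚ.*-zeroˡ (unitFraction g)))) (ℚ.+-identityˡ _)))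
    (*-nonNeg (ι≥0 (length ys)) (harmonic≥0 g))
  greedy g (suc m) xs@(_ ∷ _) len deg with Any.any? (λ y → suc g ℕ.≤? count R? y xs) ys
  ... | yes large =
    let y , g<count = Any.satisfied large
        xs′ = uncovered R? y xs
        decrease = ℕ.≤-trans (ℕ.+-monoʳ-≤ (length xs′) g<count) (ℕ.≤-reflexive (length-uncovered R? y xs))
        zs , cov , bound = greedy g m xs′
          (ℕ.s≤s⁻¹ (ℕ.≤-trans (ℕ.≤-trans (s≤s (ℕ.m≤m+n _ g)) (subst (ℕ._≤ length xs) (ℕ.+-suc (length xs′) g) decrease)) len))
          (λ x∈ → deg (proj₁ (∈-filter⁻ (λ x → ¬? (R? y x)) {xs = xs} x∈)))
    in y ∷ zs , cover y zs cov , step (length xs) (length xs′) (length zs) decrease bound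
    where
    cover : ∀ y zs → (∀ {x} → x ∈ uncovered R? y xs → Any (λ z → R z x) zs) → ∀ {x} → x ∈ xs → Any (λ z → R z x) (y ∷ zs)
    cover y zs cov {x} x∈ with R? y x
    ... | yes r = here r
    ... | no ¬r = there (cov (∈-filter⁺ (λ x → ¬? (R? y x)) x∈ ¬r))
    -- The new pick adds `ι d` on the left. It is paid for by the at least g + 1 newly covered
    -- elements, each of weight d/(g + 1).
    step : ∀ k k′ l → k′ ℕ.+ suc g ℕ.≤ k →
           ι l ℚ.* ι d ℚ.≤ ι k′ ℚ.* ι d ℚ.* unitFraction g ℚ.+ ι (length ys) ℚ.* harmonic g →
           ι (suc l) ℚ.* ι d ℚ.≤ ι k ℚ.* ι d ℚ.* unitFraction g ℚ.+ ι (length ys) ℚ.* harmonic g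
    step k k′ l k′+g<k h = begin
      ι (suc l) ℚ.* D                              ≡⟨ cong (ℚ._* D) (ι-+ 1 l) ⟩
      (1ℚ ℚ.+ ι l) ℚ.* D                           ≡⟨ solve 2 (λ l D → (con 1ℚ :+ l) :* D := D :* con 1ℚ :+ l :* D) refl (ι l) D ⟩
      D ℚ.* 1ℚ ℚ.+ ι l ℚ.* D                       ≤⟨ ℚ.+-monoʳ-≤ (D ℚ.* 1ℚ) h ⟩
      D ℚ.* 1ℚ ℚ.+ (ι k′ ℚ.* D ℚ.* u ℚ.+ c)        ≡⟨ cong (λ x → D ℚ.* x ℚ.+ (ι k′ ℚ.* D ℚ.* u ℚ.+ c)) (ι*1/≡1 (suc g)) ⟨
      D ℚ.* (G ℚ.* u) ℚ.+ (ι k′ ℚ.* D ℚ.* u ℚ.+ c) ≡⟨ solve 5 (λ D G u k c → D :* (G :* u) :+ (k :* D :* u :+ c) := (k :+ G) :* D :* u :+ c) refl D G u (ι k′) c ⟩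
      (ι k′ ℚ.+ G) ℚ.* D ℚ.* u ℚ.+ c               ≡⟨ cong (λ x → x ℚ.* D ℚ.* u ℚ.+ c) (ι-+ k′ (suc g)) ⟨
      ι (k′ ℕ.+ suc g) ℚ.* D ℚ.* u ℚ.+ c           ≤⟨ ℚ.+-monoˡ-≤ c (*-monoʳ (unitFraction≥0 g) (*-monoʳ (ι≥0 d) (ι-mono k′+g<k))) ⟩
      ι k ℚ.* D ℚ.* u ℚ.+ c                        ∎
      where
      open ℚ.≤-Reasoning
      open +-*-Solver
      D = ι d
      G = ι (suc g)
      u = unitFraction g
      c = ι (length ys) ℚ.* harmonic g
  -- At level 0 no `y` covers any remaining element, so double counting gives `length xs ℕ.* d` ≤ 0,
  -- although both factors are positive.
  greedy zero (suc m) xs@(_ ∷ _) len deg | no ¬large =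
    contradiction (ℕ.≤-trans (double-counting R? ys xs deg λ y∈ → ℕ.s≤s⁻¹ (ℕ.≰⇒> (All.lookup (All.¬Any⇒All¬ ys ¬large) y∈)))
                             (ℕ.≤-reflexive (ℕ.*-zeroʳ (length ys))))
                  (ℕ.<⇒≱ (ℕ.>-nonZero⁻¹ (length xs ℕ.* d) {{ℕ.m*n≢0 (length xs) d}}))
  greedy (suc g) (suc m) xs@(_ ∷ _) len deg | no ¬large =
    -- The level has dropped, so the recursion bound may be reset.
    let zs , cov , bound = greedy g (length xs) xs ℕ.≤-refl deg
        small = double-counting R? ys xs deg λ y∈ → ℕ.s≤s⁻¹ (ℕ.≰⇒> (All.lookup (All.¬Any⇒All¬ ys ¬large) y∈))
    in zs , cov , ℚ.≤-trans bound (phase (subst₂ ℚ._≤_ (ι-* (length xs) d) (ι-* (length ys) (suc g)) (ι-mono small)))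
    where
    M = ι (length ys)
    X = ι (length xs) ℚ.* ι d
    u = unitFraction g
    v = unitFraction (suc g)
    -- Splitting `u` leaves the excess X u v. Since X ≤ M (g + 1) and (g + 1) u = 1, it is at most M
    -- v, the term that `harmonic (suc g)` adds.
    phase : X ℚ.≤ M ℚ.* ι (suc g) → X ℚ.* u ℚ.+ M ℚ.* harmonic g ℚ.≤ X ℚ.* v ℚ.+ M ℚ.* harmonic (suc g)
    phase small = begin
      X ℚ.* u ℚ.+ M ℚ.* harmonic g                                       ≡⟨ cong (λ x → X ℚ.* x ℚ.+ M ℚ.* harmonic g) (unitFraction-split g) ⟩
      X ℚ.* (v ℚ.+ u ℚ.* v) ℚ.+ M ℚ.* harmonic g                         ≡⟨ solve 5 (λ X u v M h → X :* (v :+ u :* v) :+ M :* h := X :* (u :* v) :+ (X :* v :+ M :* h)) refl X u v M (harmonic g) ⟩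
      X ℚ.* (u ℚ.* v) ℚ.+ (X ℚ.* v ℚ.+ M ℚ.* harmonic g)                 ≤⟨ ℚ.+-monoˡ-≤ (X ℚ.* v ℚ.+ M ℚ.* harmonic g) (*-monoʳ (*-nonNeg (unitFraction≥0 g) (unitFraction≥0 (suc g))) small) ⟩
      M ℚ.* ι (suc g) ℚ.* (u ℚ.* v) ℚ.+ (X ℚ.* v ℚ.+ M ℚ.* harmonic g)   ≡⟨ solve 6 (λ X u v M h G → M :* G :* (u :* v) :+ (X :* v :+ M :* h) := M :* ((G :* u) :* v) :+ (X :* v :+ M :* h)) refl X u v M (harmonic g) (ι (suc g)) ⟩
      M ℚ.* ((ι (suc g) ℚ.* u) ℚ.* v) ℚ.+ (X ℚ.* v ℚ.+ M ℚ.* harmonic g) ≡⟨ cong (λ x → M ℚ.* (x ℚ.* v) ℚ.+ (X ℚ.* v ℚ.+ M ℚ.* harmonic g)) (ι*1/≡1 (suc g)) ⟩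
      M ℚ.* (1ℚ ℚ.* v) ℚ.+ (X ℚ.* v ℚ.+ M ℚ.* harmonic g)                ≡⟨ solve 4 (λ X v M h → M :* (con 1ℚ :* v) :+ (X :* v :+ M :* h) := X :* v :+ M :* (h :+ v)) refl X v M (harmonic g) ⟩
      X ℚ.* v ℚ.+ M ℚ.* harmonic (suc g)                                 ∎
      where
      open ℚ.≤-Reasoning
      open +-*-Solver

-- Harmonic sums against the binary and the natural logarithm.

2^⌊log₂n⌋≤n : ∀ n .{{_ : NonZero n}} → 2 ^ ⌊log₂ n ⌋ ℕ.≤ n
2^⌊log₂n⌋≤n (suc n) = go n (<-wellFounded (suc n))
  where
  go : ∀ n (a : Acc ℕ._<_ (suc n)) → 2 ^ ⌊log2⌋ (suc n) a ℕ.≤ suc n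
  go zero    _        = s≤s z≤n
  -- On n + 2 the function `⌊log2⌋` unfolds to one more than its value at 1 + ⌊n/2⌋, so doubling the
  -- induction hypothesis suffices.
  go (suc n) (acc rs) = ℕ.≤-trans (ℕ.*-monoʳ-≤ 2 (go ℕ.⌊ n /2⌋ (rs _))) (begin
    2 ℕ.* suc ℕ.⌊ n /2⌋             ≡⟨ cong (suc ℕ.⌊ n /2⌋ ℕ.+_) (ℕ.+-identityʳ _) ⟩
    suc ℕ.⌊ n /2⌋ ℕ.+ suc ℕ.⌊ n /2⌋ ≡⟨ cong suc (ℕ.+-suc _ _) ⟩
    2 ℕ.+ (ℕ.⌊ n /2⌋ ℕ.+ ℕ.⌊ n /2⌋) ≤⟨ ℕ.+-monoʳ-≤ (2 ℕ.+ ℕ.⌊ n /2⌋) (ℕ.⌊n/2⌋≤⌈n/2⌉ n) ⟩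
    2 ℕ.+ (ℕ.⌊ n /2⌋ ℕ.+ ℕ.⌈ n /2⌉) ≡⟨ cong (2 ℕ.+_) (ℕ.⌊n/2⌋+⌈n/2⌉≡n n) ⟩
    2 ℕ.+ n                         ∎)
    where open ℕ.≤-Reasoning

-- Oresme's grouping: the m + 1 new terms are each at least 1/(2m + 2).
harmonic-double : ∀ m → harmonic m ℚ.+ ½ ℚ.≤ harmonic (suc m ℕ.+ m)
harmonic-double m = subst (harmonic m ℚ.+ ½ ℚ.≤_) (sym (Σ<-+ m (suc m) _))
  (ℚ.+-monoʳ-≤ (harmonic m) (subst (ℚ._≤ Σ< (suc m) (λ i → unitFraction (suc (m ℕ.+ i)))) (Σ<-block m 1)
    (Σ<-mono (suc m) λ j j<m → unitFraction-anti (subst (suc (m ℕ.+ j) ℕ.≤_) (cong (m ℕ.+_) (sym (ℕ.+-identityʳ (suc m))))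
      (subst (ℕ._≤ m ℕ.+ suc m) (ℕ.+-suc m j) (ℕ.+-monoʳ-≤ m j<m))))))

harmonic-2^ : ∀ k m → 2 ^ k ℕ.≤ suc m → ι k ℚ.* ½ ℚ.≤ harmonic m
harmonic-2^ k m h = ℚ.≤-trans (go k) (harmonic-mono (ℕ.s≤s⁻¹ (subst (ℕ._≤ suc m) (2^k k) h)))
  where
  -- This is 2^k - 1, matching the shift in `harmonic`; its recursion is the step from m to 2m + 1
  -- in `harmonic-double`.
  mersenne : ℕ → ℕ
  mersenne zero    = 0
  mersenne (suc k) = suc (mersenne k) ℕ.+ mersenne k
  2^k : ∀ k → 2 ^ k ≡ suc (mersenne k)
  2^k zero    = refl
  2^k (suc k) = trans (cong (λ e → e ℕ.+ (e ℕ.+ 0)) (2^k k))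
    (trans (cong (suc (mersenne k) ℕ.+_) (ℕ.+-identityʳ _)) (ℕ.+-suc (suc (mersenne k)) (mersenne k)))
  go : ∀ k → ι k ℚ.* ½ ℚ.≤ harmonic (mersenne k)
  go zero    = ℚ.≤-refl
  go (suc k) = begin
    ι (suc k) ℚ.* ½             ≡⟨ cong (ℚ._* ½) (ι-+ 1 k) ⟩
    (1ℚ ℚ.+ ι k) ℚ.* ½          ≡⟨ solve 1 (λ k → (con 1ℚ :+ k) :* con ½ := k :* con ½ :+ con ½) refl (ι k) ⟩
    ι k ℚ.* ½ ℚ.+ ½             ≤⟨ ℚ.+-monoˡ-≤ ½ (go k) ⟩
    harmonic (mersenne k) ℚ.+ ½ ≤⟨ harmonic-double (mersenne k) ⟩
    harmonic (mersenne (suc k)) ∎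
    where
    open ℚ.≤-Reasoning
    open +-*-Solver

harmonic-⌊log₂⌋ : ∀ n → ι ⌊log₂ suc n ⌋ ℚ.* ½ ℚ.≤ harmonic n
harmonic-⌊log₂⌋ n = harmonic-2^ ⌊log₂ suc n ⌋ n (2^⌊log₂n⌋≤n (suc n))

-- `harmonic n` is the right-endpoint sum of mesh 1 for the decreasing function 1/t, and refining
-- the mesh can only increase such a sum.
harmonic≤riemann : ∀ n m → harmonic n ℚ.≤ riemann n (suc m)
harmonic≤riemann n m = subst₂ (λ k l → harmonic k ℚ.≤ riemann n l) (ℕ.*-identityʳ n) (ℕ.*-identityˡ (suc m)) (riemann-lower n 1 m)

-- Null sequences and termwise comparison of reals.

-- Here `r` is 1/∣c∣, passed explicitly so that for concrete `c` its defining equation holds by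
-- computation. It suffices that the unit fraction falls below r ε.
c*unitFraction→0 : ∀ c r → ℚ.Positive r → ℚ.∣ c ∣ ℚ.* r ≡ 1ℚ → (f : ℕ → ℕ) →
                   (∀ K → ∃ λ N → ∀ n → N ℕ.≤ n → K ℕ.≤ f n) → TendsToZero (λ n → fromℚ (c ℚ.* unitFraction (f n)))
c*unitFraction→0 c r r>0 cr≡1 f diverges ε ε>0 =
  let K , small = archimedean (r ℚ.* ε) (ℚ.positive⁻¹ (r ℚ.* ε) {{ℚ.pos*pos⇒pos r {{r>0}} ε {{ℚ.positive ε>0}}}})
      N , large = diverges K
  in N , λ n N≤n ε′ ε′>0 → 0 , λ _ _ → ℚ.≤-trans (begin
       ℚ.∣ c ℚ.* unitFraction (f n) ∣       ≡⟨ ℚ.∣p*q∣≡∣p∣*∣q∣ c _ ⟩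
       ℚ.∣ c ∣ ℚ.* ℚ.∣ unitFraction (f n) ∣ ≡⟨ cong (ℚ.∣ c ∣ ℚ.*_) (ℚ.0≤p⇒∣p∣≡p (unitFraction≥0 (f n))) ⟩
       ℚ.∣ c ∣ ℚ.* unitFraction (f n)       ≤⟨ *-monoˡ (ℚ.0≤∣p∣ c) (ℚ.≤-trans (unitFraction-anti (large n N≤n)) small) ⟩
       ℚ.∣ c ∣ ℚ.* (r ℚ.* ε)                ≡⟨ ℚ.*-assoc ℚ.∣ c ∣ r ε ⟨
       ℚ.∣ c ∣ ℚ.* r ℚ.* ε                  ≡⟨ cong (ℚ._* ε) cr≡1 ⟩
       1ℚ ℚ.* ε                             ≡⟨ ℚ.*-identityˡ ε ⟩
       ε                                    ∎) (p≤p+q (ℚ.<⇒≤ ε′>0))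
  where open ℚ.≤-Reasoning

termwise-≤ : ∀ {x y} → (∀ m → ℝ.seq x m ℚ.≤ ℝ.seq y m) → x ≤ y
termwise-≤ h ε ε>0 = 0 , λ m _ → ℚ.≤-trans (h m) (p≤p+q (ℚ.<⇒≤ ε>0))

-- The two asymptotic bounds.

-- The greedy cover starts at level n with d = n². The bound is phrased with `harmonic p`, that is H
-- n - 1, because this is the sum that lies below log n.
κ-upper : ∀ p → let n = suc p in ι (κ n) ℚ.* ι (n ^ 2) ℚ.≤ ι (suc n !) ℚ.* (harmonic p ℚ.+ ι 2)
κ-upper p =
  let zs , cov , bound = greedy contains? (permutations (suc n)) (n ^ 2) {{m^n≢0 n 2}} n _ (permutations n) ℕ.≤-refl (λ {π} _ → degree-covers-≥ π)
      covers : CoversAll zs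
      covers π =
        let σ , σ∈ , π≈σ = find (permutations-enumerate n π)
        in Any.map (λ {ρ} → Contains-resp {ρ = ρ} {ρ} {σ} {π} (λ _ → refl) (λ i → sym (π≈σ i))) (cov σ∈)
  in begin
    ι (κ n) ℚ.* D       ≤⟨ *-monoʳ (ι≥0 (n ^ 2)) (ι-mono (κ-minimal zs covers)) ⟩
    ι (length zs) ℚ.* D ≤⟨ bound ⟩
    ι (length (permutations n)) ℚ.* D ℚ.* u ℚ.+ ι (length (permutations (suc n))) ℚ.* harmonic n
      ≡⟨ cong₂ (λ k l → ι k ℚ.* D ℚ.* u ℚ.+ ι l ℚ.* harmonic n) (length-permutations n) (length-permutations (suc n)) ⟩
    ι (n !) ℚ.* D ℚ.* u ℚ.+ M ℚ.* harmonic n         ≡⟨ cong (λ x → x ℚ.* u ℚ.+ M ℚ.* harmonic n) (ι-* (n !) (n ^ 2)) ⟨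
    -- The initial weight n! n²/(n + 1) is generously replaced by (n + 1)!, which contributes one
    -- unit of the final 2.
    ι (n ! ℕ.* n ^ 2) ℚ.* u ℚ.+ M ℚ.* harmonic n     ≤⟨ ℚ.+-monoˡ-≤ (M ℚ.* harmonic n) (*-monoʳ (unitFraction≥0 n) (ι-mono n!n²≤[n+1]![n+1])) ⟩
    ι (suc n ! ℕ.* suc n) ℚ.* u ℚ.+ M ℚ.* harmonic n ≡⟨ cong (λ x → x ℚ.* u ℚ.+ M ℚ.* harmonic n) (ι-* (suc n !) (suc n)) ⟩
    M ℚ.* ι (suc n) ℚ.* u ℚ.+ M ℚ.* harmonic n       ≡⟨ solve 4 (λ M i u h → M :* i :* u :+ M :* h := M :* (h :+ i :* u)) refl M (ι (suc n)) u (harmonic n) ⟩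
    M ℚ.* (harmonic n ℚ.+ ι (suc n) ℚ.* u)           ≡⟨ cong (λ x → M ℚ.* (harmonic n ℚ.+ x)) (ι*1/≡1 (suc n)) ⟩
    -- The last harmonic term 1/(n + 1) is rounded up to the other unit.
    M ℚ.* (harmonic p ℚ.+ unitFraction n ℚ.+ 1ℚ)     ≤⟨ *-monoˡ (ι≥0 (suc n !)) (ℚ.+-monoˡ-≤ 1ℚ (ℚ.+-monoʳ-≤ (harmonic p) (unitFraction-anti {0} {n} ℕ.z≤n))) ⟩
    M ℚ.* (harmonic p ℚ.+ 1ℚ ℚ.+ 1ℚ)                 ≡⟨ cong (M ℚ.*_) (ℚ.+-assoc (harmonic p) 1ℚ 1ℚ) ⟩
    M ℚ.* (harmonic p ℚ.+ ι 2)                       ∎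
  where
  n = suc p
  D = ι (n ^ 2)
  M = ι (suc n !)
  u = unitFraction n
  n!n²≤[n+1]![n+1] : n ! ℕ.* n ^ 2 ℕ.≤ suc n ! ℕ.* suc n
  n!n²≤[n+1]![n+1] = ℕ.≤-trans (ℕ.*-monoʳ-≤ (n !) (ℕ.^-monoˡ-≤ 2 (ℕ.n≤1+n n)))
    (ℕ.≤-reflexive (trans (cong (n ! ℕ.*_) (cong (suc n ℕ.*_) (ℕ.*-identityʳ (suc n)))) (x∙yz≈yx∙z (n !) (suc n) (suc n))))
    where open CommutativeSemigroup ℕ.*-commutativeSemigroup using (x∙yz≈yx∙z)
  open ℚ.≤-Reasoning
  open +-*-Solver

-- `κ-lower` gives (n + 1)! ≤ κ n (n + 1)², and the correction 1 - 2/(n + 1) is chosen because (n +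
-- 1)² - 2(n + 1) = n² - 1 ≤ n².
lower-bound : ∀ n .{{_ : NonZero n}} →
              (+ (suc n !) / n ^ 2) {{m^n≢0 n 2}} ℚ.* (1ℚ ℚ.+ ℚ.- ι 2 ℚ.* unitFraction n) ℚ.≤ ι (κ n)
lower-bound n@(suc _) = begin
  (+ (suc n !) / n ^ 2) ℚ.* c               ≡⟨ cong (ℚ._* c) (/≡ι*1/ (suc n !) (n ^ 2)) ⟩
  ι (suc n !) ℚ.* v ℚ.* c                   ≤⟨ *-monoʳ c≥0 (*-monoʳ (1/≥0 (n ^ 2)) (ι-mono [n+1]!≤)) ⟩
  ι (κ n ℕ.* (suc n ℕ.* suc n)) ℚ.* v ℚ.* c ≡⟨ cong (λ x → x ℚ.* v ℚ.* c) (trans (ι-* (κ n) _) (cong (ι (κ n) ℚ.*_) (ι-* (suc n) (suc n)))) ⟩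
  ι (κ n) ℚ.* (i ℚ.* i) ℚ.* v ℚ.* c         ≡⟨ solve 4 (λ k i v u → k :* (i :* i) :* v :* (con 1ℚ :+ :- con (ι 2) :* u) := k :* ((i :* i :- con (ι 2) :* i :* (i :* u)) :* v)) refl (ι (κ n)) i v u ⟩
  ι (κ n) ℚ.* ((i ℚ.* i ℚ.- ι 2 ℚ.* i ℚ.* (i ℚ.* u)) ℚ.* v)
    ≡⟨ cong₂ (λ i x → ι (κ n) ℚ.* ((i ℚ.* i ℚ.- ι 2 ℚ.* i ℚ.* x) ℚ.* v)) (ι-+ 1 n) (ι*1/≡1 (suc n)) ⟩
  ι (κ n) ℚ.* (((1ℚ ℚ.+ m) ℚ.* (1ℚ ℚ.+ m) ℚ.- ι 2 ℚ.* (1ℚ ℚ.+ m) ℚ.* 1ℚ) ℚ.* v)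
    ≡⟨ solve 3 (λ k m v → k :* (((con 1ℚ :+ m) :* (con 1ℚ :+ m) :- con (ι 2) :* (con 1ℚ :+ m) :* con 1ℚ) :* v)
                          := k :* ((m :* (m :* con 1ℚ) :- con 1ℚ) :* v)) refl (ι (κ n)) m v ⟩
  ι (κ n) ℚ.* ((m ℚ.* (m ℚ.* 1ℚ) ℚ.- 1ℚ) ℚ.* v) ≡⟨ cong (λ x → ι (κ n) ℚ.* ((x ℚ.- 1ℚ) ℚ.* v)) (trans (ι-* n (n ℕ.* 1)) (cong (m ℚ.*_) (ι-* n 1))) ⟨
  ι (κ n) ℚ.* ((ι (n ^ 2) ℚ.- 1ℚ) ℚ.* v)        ≤⟨ *-monoˡ (ι≥0 (κ n)) (*-monoʳ (1/≥0 (n ^ 2)) (subst (ι (n ^ 2) ℚ.- 1ℚ ℚ.≤_) (ℚ.+-identityʳ (ι (n ^ 2))) (ℚ.+-monoʳ-≤ (ι (n ^ 2)) -1≤0))) ⟩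
  ι (κ n) ℚ.* (ι (n ^ 2) ℚ.* v)                 ≡⟨ cong (ι (κ n) ℚ.*_) (ι*1/≡1 (n ^ 2)) ⟩
  ι (κ n) ℚ.* 1ℚ                                ≡⟨ ℚ.*-identityʳ _ ⟩
  ι (κ n)                                       ∎
  where
  open ℚ.≤-Reasoning
  open +-*-Solver
  instance n²≢0 = m^n≢0 n 2
  u = unitFraction n
  v = + 1 / n ^ 2
  i = ι (suc n)
  m = ι n
  c = 1ℚ ℚ.+ ℚ.- ι 2 ℚ.* u
  -1≤0 : ℚ.- 1ℚ ℚ.≤ 0ℚ
  -1≤0 = ℚ.neg-antimono-≤ (ι≥0 1)
  c≥0 : 0ℚ ℚ.≤ c
  c≥0 = subst (0ℚ ℚ.≤_) (solve 1 (λ u → con (ι 2) :* (con ½ :- u) := con 1ℚ :+ :- con (ι 2) :* u) refl u)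
    (*-nonNeg (ι≥0 2) (subst (ℚ._≤ ½ ℚ.- u) (ℚ.+-inverseʳ u) (ℚ.+-monoˡ-≤ (ℚ.- u) (unitFraction-anti {1} {n} (ℕ.s≤s ℕ.z≤n)))))
  [n+1]!≤ : suc n ! ℕ.≤ κ n ℕ.* (suc n ℕ.* suc n)
  [n+1]!≤ = ℕ.≤-trans (ℕ.*-monoʳ-≤ (suc n) (κ-lower n)) (ℕ.≤-reflexive (x∙yz≈y∙xz* (suc n) (κ n) (suc n)))
    where open CommutativeSemigroup ℕ.*-commutativeSemigroup using () renaming (x∙yz≈y∙xz to x∙yz≈y∙xz*)

-- With L = `harmonic p` at least ⌊log₂ n⌋/2, the summand 2 in `κ-upper` is at most 4L/⌊log₂ n⌋.
-- Factoring out L allows it to be replaced by any Riemann sum for log n.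
upper-bound : ∀ p m → let n = suc p in 2 ℕ.≤ n →
              ι (κ n) ℚ.≤ riemann p (suc m) ℚ.* (+ 1 / n ^ 2) {{m^n≢0 n 2}} ℚ.* ι (suc n !) ℚ.*
                          (1ℚ ℚ.+ ι 4 ℚ.* unitFraction (ℕ.pred ⌊log₂ n ⌋))
upper-bound p m 2≤n = begin
  ι (κ n)                               ≡⟨ ℚ.*-identityʳ _ ⟨
  ι (κ n) ℚ.* 1ℚ                        ≡⟨ cong (ι (κ n) ℚ.*_) (ι*1/≡1 (n ^ 2)) ⟨
  ι (κ n) ℚ.* (ι (n ^ 2) ℚ.* v)         ≡⟨ ℚ.*-assoc (ι (κ n)) (ι (n ^ 2)) v ⟨
  ι (κ n) ℚ.* ι (n ^ 2) ℚ.* v           ≤⟨ *-monoʳ (1/≥0 (n ^ 2)) (κ-upper p) ⟩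
  M ℚ.* (L ℚ.+ ι 2) ℚ.* v               ≤⟨ *-monoʳ (1/≥0 (n ^ 2)) (*-monoˡ (ι≥0 (suc n !)) (ℚ.+-monoʳ-≤ L 2≤L*4u)) ⟩
  M ℚ.* (L ℚ.+ L ℚ.* (ι 4 ℚ.* u)) ℚ.* v ≡⟨ solve 4 (λ M L u v → M :* (L :+ L :* (con (ι 4) :* u)) :* v := L :* (v :* M :* (con 1ℚ :+ con (ι 4) :* u))) refl M L u v ⟩
  L ℚ.* (v ℚ.* M ℚ.* e)                 ≤⟨ *-monoʳ (*-nonNeg (*-nonNeg (1/≥0 (n ^ 2)) (ι≥0 (suc n !))) (ℚ.+-mono-≤ (ι≥0 1) 4u≥0)) (harmonic≤riemann p m) ⟩
  R ℚ.* (v ℚ.* M ℚ.* e)                 ≡⟨ solve 4 (λ R v M e → R :* (v :* M :* e) := R :* v :* M :* e) refl R v M e ⟩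
  R ℚ.* v ℚ.* M ℚ.* e                   ∎
  where
  open ℚ.≤-Reasoning
  open +-*-Solver
  n = suc p
  instance n²≢0 = m^n≢0 n 2
  -- The predecessor makes `u` equal to 1/⌊log₂ n⌋; the logarithm is positive because 2 ≤ n.
  k = ℕ.pred ⌊log₂ n ⌋
  u = unitFraction k
  v = + 1 / n ^ 2
  M = ι (suc n !)
  L = harmonic p
  R = riemann p (suc m)
  e = 1ℚ ℚ.+ ι 4 ℚ.* u
  4u≥0 : 0ℚ ℚ.≤ ι 4 ℚ.* u
  4u≥0 = *-nonNeg (ι≥0 4) (unitFraction≥0 k)
  2≤L*4u : ι 2 ℚ.≤ L ℚ.* (ι 4 ℚ.* u)
  2≤L*4u = begin
    ι 2                               ≡⟨ cong (ι 2 ℚ.*_) (ι*1/≡1 (suc k)) ⟨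
    ι 2 ℚ.* (ι (suc k) ℚ.* u)         ≡⟨ solve 2 (λ i u → con (ι 2) :* (i :* u) := i :* con ½ :* (con (ι 4) :* u)) refl (ι (suc k)) u ⟩
    ι (suc k) ℚ.* ½ ℚ.* (ι 4 ℚ.* u)   ≡⟨ cong (λ l → ι l ℚ.* ½ ℚ.* (ι 4 ℚ.* u)) (ℕ.suc-pred ⌊log₂ n ⌋ {{ℕ.>-nonZero (⌊log₂⌋-mono-≤ 2≤n)}}) ⟩
    ι ⌊log₂ n ⌋ ℚ.* ½ ℚ.* (ι 4 ℚ.* u) ≤⟨ *-monoʳ 4u≥0 (harmonic-⌊log₂⌋ p) ⟩
    L ℚ.* (ι 4 ℚ.* u)                 ∎

pred-⌊log₂⌋-diverges : ∀ K → ∃ λ N → ∀ n → N ℕ.≤ n → K ℕ.≤ ℕ.pred ⌊log₂ n ⌋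
pred-⌊log₂⌋-diverges K = 2 ^ suc K , λ n N≤n →
  ℕ.pred-mono-≤ (subst (ℕ._≤ ⌊log₂ n ⌋) (⌊log₂[2^n]⌋≡n (suc K)) (⌊log₂⌋-mono-≤ N≤n))

theorem2 : ∃ λ (δ : ℕ → ℝ) → ∃ λ (η : ℕ → ℝ) → TendsToZero δ × TendsToZero η ×
    ∃ λ (N : ℕ) → ∀ (n : ℕ) .{{_ : NonZero n}} → N ℕ.≤ n →
    fromℚ ((+ (suc n !) / n ^ 2) {{m^n≢0 n 2}}) * (fromℕ 1 + δ n) ≤ fromℕ (κ n) ×
    fromℕ (κ n) ≤ log n * fromℚ ((+ 1 / n ^ 2) {{m^n≢0 n 2}}) * fromℕ (suc n !) * (fromℕ 1 + η n)
theorem2 =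
    (λ n → fromℚ (ℚ.- ι 2 ℚ.* unitFraction n))
  , (λ n → fromℚ (ι 4 ℚ.* unitFraction (ℕ.pred ⌊log₂ n ⌋)))
  , c*unitFraction→0 (ℚ.- ι 2) ½ _ refl (λ n → n) (λ K → K , λ _ K≤n → K≤n)
  , c*unitFraction→0 (ι 4) (+ 1 / 4) _ refl (λ n → ℕ.pred ⌊log₂ n ⌋) pred-⌊log₂⌋-diverges
  -- From n = 2 on ⌊log₂ n⌋ is positive, so the chosen error term is 4/⌊log₂ n⌋.
  , 2
  , λ { n@(suc p) 2≤n →
          termwise-≤ {fromℚ ((+ (suc n !) / n ^ 2) {{m^n≢0 n 2}}) * (fromℕ 1 + fromℚ (ℚ.- ι 2 ℚ.* unitFraction n))} {fromℕ (κ n)} (λ _ → lower-bound n)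
        , termwise-≤ {fromℕ (κ n)} {log n * fromℚ ((+ 1 / n ^ 2) {{m^n≢0 n 2}}) * fromℕ (suc n !) * (fromℕ 1 + fromℚ (ι 4 ℚ.* unitFraction (ℕ.pred ⌊log₂ n ⌋)))} (λ m → upper-bound p m 2≤n) }
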